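{- Let $q=2^r$ with $r\geq3$, let $m\ge1$ and put $N_2=(q-1)^m$. Then for every $h=1,2,\dots$, \[ MK^{mh}=\sum_{l=0}^{h-1}(-1)^{h+l+1}\binom{h}{l}(q-1)^{m(h-l)}MK^{ml} +q\sum_{j=0}^{\min\{(q-1)^m,h\}}(-1)^{h+j}D_{m,j}\sum_{t=j}^{h}t!\,S(h,t)\,2^{h-t}\binom{(q-1)^m-j}{(q-1)^m-t}. \] Moreover, \[ D_{m,j}=\sum\prod_{\beta\in\mathbb{F}_q}\binom{\sigma(m,q;\beta)}{\nu_\beta}, \] where the sum runs over all families of integers $\{\nu_\beta\}_{\beta\in\mathbb{F}_q}$ with $0\le\nu_\beta\le\sigma(m,q;\beta)$, $\sum_\beta\nu_\beta=j$ and $\sum_\beta\nu_\beta\beta=0$ (in $\mathbb{F}_q$), and \[ \sigma(m,q;\beta)=|\{(\alpha_1,\dots,\alpha_m)\in(\mathbb{F}_q^*)^m:\alpha_1+\cdots+\alpha_m+\alpha_1^{ -1}+\cdots+\alpha_m^{ -1}=\beta\}| =\sum\lambda(\alpha_1+\cdots+\alpha_m)+q^{ -1}\{(q-1)^m+(-1)^{m+1}\}, \] the last sum running over all $\alpha_1,\dots,\alpha_m\in\mathbb{F}_q^*$ with $\alpha_1^{ -1}+\cdots+\alpha_m^{ -1}=\beta$.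
   Context: $\mathbb{F}_q$ is the finite field with $q=2^r$ elements, $tr$ the absolute trace to $\mathbb{F}_2$, and $\lambda(x)=(-1)^{tr(x)}$. For $a\in\mathbb{F}_q^*$, $K(\lambda;a)=\sum_{\alpha\in\mathbb{F}_q^*}\lambda(\alpha+a\alpha^{ -1})$ is the Kloosterman sum, and for $h\ge0$, $MK^h=\sum_{a\in\mathbb{F}_q^*}K(\lambda;a)^h$. $S(h,t)=\frac{1}{t!}\sum_{j=0}^{t}(-1)^{t-j}\binom{t}{j}j^h$. Fix an ordering of $(\mathbb{F}_q^*)^m$ and let $w_m=(g_1,\dots,g_{N_2})\in\mathbb{F}_q^{N_2}$ with $g_i=\alpha_1+\cdots+\alpha_m+\alpha_1^{ -1}+\cdots+\alpha_m^{ -1}$ for the $i$-th tuple $(\alpha_1,\dots,\alpha_m)$. The binary linear code $D_m$ is $\{u\in\mathbb{F}_2^{N_2}:\sum_iu_ig_i=0\text{ in }\mathbb{F}_q\}$, and $D_{m,j}$ denotes the number of codewords of Hamming weight $j$ in $D_m$. -}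

module Defs where

open import Data.Nat as ℕ using (ℕ; zero; suc; _∸_; _!)
open import Data.Nat.Properties using (_!≢0)
open import Data.Nat.Combinatorics using (_C_)
open import Data.Integer as ℤ using (ℤ; _/ℕ_; +_; -[1+_]; 0ℤ; 1ℤ; -1ℤ)
open import Data.Fin as Fin using (Fin)
open import Data.Fin.Properties as FinP using ()
open import Data.Vec as Vec using (Vec; []; _∷_)
open import Data.List as List using (List; []; _∷_)
open import Data.Bool using (Bool; true; false; if_then_else_; _∧_)
open import Algebra.Structures using (IsCommutativeRing)
open import Function.Bundles using (_↔_; Inverse)
open import Relation.Binary.PropositionalEquality
open import Relation.Binary.Definitions using (DecidableEquality)
open import Relation.Nullary using (¬_; yes; no; does)

sumℤ : List ℤ → ℤ
sumℤ = List.foldr ℤ._+_ 0ℤ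

sumℕ : List ℕ → ℕ
sumℕ = List.foldr ℕ._+_ 0

range : ℕ → ℕ → List ℕ
range a b = List.map (a ℕ.+_) (List.upTo (suc b ∸ a))

sign : ℕ → ℤ
sign n = -1ℤ ℤ.^ n

binomℤ : ℕ → ℤ → ℕ
binomℤ n (+ k)    = n C k
binomℤ n -[1+ _ ] = 0

-- Stirling number of the second kind, defined as in the paper:
-- S(h,t) = (1/t!) Σ_{j=0}^{t} (-1)^{t-j} (t choose j) j^h
-- (the division is exact; we use integer division by t!).
S : ℕ → ℕ → ℤ
S h t = _/ℕ_ (sumℤ (List.map (λ j → sign (t ∸ j) ℤ.* + (t C j) ℤ.* + (j ℕ.^ h))
                              (range 0 t)))
             (t !) {{t !≢0}}

-- A finite field with exactly 2^r elements.
-- (A commutative ring with 0 ≠ 1 in which every nonzero element has an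
--  inverse, whose carrier is in bijection with Fin (2^r).  Such a field is
--  F_q with q = 2^r, unique up to isomorphism.)

record GF2^ (r : ℕ) : Set₁ where
  infixl 6 _+_
  infixl 7 _*_
  field
    F      : Set
    _+_    : F → F → F
    _*_    : F → F → F
    -_     : F → F
    0#     : F
    1#     : F
    isCommutativeRing : IsCommutativeRing _≡_ _+_ _*_ -_ 0# 1#
    0≢1    : ¬ (0# ≡ 1#)
    _⁻¹    : F → F
    ⁻¹-inverse : ∀ x → ¬ (x ≡ 0#) → x * (x ⁻¹) ≡ 1#
    enum   : Fin (2 ℕ.^ r) ↔ F

module FF {r : ℕ} (K : GF2^ r) where
  open GF2^ K

  q : ℕ
  q = 2 ℕ.^ r

  private
    to : Fin q → F
    to = Inverse.to enum
    from : F → Fin q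
    from = Inverse.from enum
    to∘from : ∀ x → to (from x) ≡ x
    to∘from x = Inverse.inverseˡ enum refl

  _≟_ : DecidableEquality F
  x ≟ y with from x FinP.≟ from y
  ... | yes p = yes (trans (sym (to∘from x)) (trans (cong to p) (to∘from y)))
  ... | no ¬p = no (λ e → ¬p (cong from e))

  isZero : F → Bool
  isZero x = does (x ≟ 0#)

  elems : List F
  elems = List.map to (List.allFin q)

  elems* : List F
  elems* = List.foldr (λ x xs → if isZero x then xs else x ∷ xs) [] elems

  Σ* : (F → ℤ) → ℤ
  Σ* f = sumℤ (List.map f elems*)

  pow : F → ℕ → F
  pow x zero    = 1#
  pow x (suc n) = x * pow x n

  tr : F → F
  tr x = List.foldr _+_ 0# (List.map (λ i → pow x (2 ℕ.^ i)) (List.upTo r))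

  λ' : F → ℤ
  λ' x = if isZero (tr x) then 1ℤ else -1ℤ

  Kl : F → ℤ
  Kl a = Σ* (λ α → λ' (α + a * (α ⁻¹)))

  MK : ℕ → ℤ
  MK h = Σ* (λ a → Kl a ℤ.^ h)

  tuples : (m : ℕ) → List (Vec F m)
  tuples zero    = [] ∷ []
  tuples (suc m) = List.concatMap (λ x → List.map (x ∷_) (tuples m)) elems*

  vsum : ∀ {m} → Vec F m → F
  vsum = Vec.foldr _ _+_ 0#

  vinvsum : ∀ {m} → Vec F m → F
  vinvsum v = vsum (Vec.map _⁻¹ v)

  N₂ : ℕ → ℕ
  N₂ m = List.length (tuples m)

  w : (m : ℕ) → Vec F (N₂ m)
  w m = Vec.map (λ v → vsum v + vinvsum v) (Vec.fromList (tuples m))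

  allBin : (n : ℕ) → List (Vec Bool n)
  allBin zero    = [] ∷ []
  allBin (suc n) = List.concatMap (λ b → List.map (b ∷_) (allBin n)) (false ∷ true ∷ [])

  wt : ∀ {n} → Vec Bool n → ℕ
  wt = Vec.foldr _ (λ b k → if b then suc k else k) 0

  -- Σ u_i g_i in F_q, where u_i ∈ F_2 ⊆ F_q
  dot : ∀ {n} → Vec Bool n → Vec F n → F
  dot u g = vsum (Vec.zipWith (λ b x → if b then x else 0#) u g)

  -- D_{m,j}: number of codewords of D_m of Hamming weight j
  D : ℕ → ℕ → ℕ
  D m j = sumℕ (List.map (λ u → if does (wt u ℕ.≟ j) ∧ isZero (dot u (w m)) then 1 else 0)
                         (allBin (N₂ m)))

  σ : ℕ → F → ℕ
  σ m β = sumℕ (List.map (λ v → if does ((vsum v + vinvsum v) ≟ β) then 1 else 0) (tuples m))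

  σsum : ℕ → F → ℤ
  σsum m β = sumℤ (List.map (λ v → if does (vinvsum v ≟ β) then λ' (vsum v) else 0ℤ) (tuples m))

  _·_ : ℕ → F → F
  zero  · x = 0#
  suc n · x = x + n · x

  bounded : ∀ {n} → Vec ℕ n → List (Vec ℕ n)
  bounded []       = [] ∷ []
  bounded (b ∷ bs) = List.concatMap (λ k → List.map (k ∷_) (bounded bs)) (range 0 b)

  -- families {ν_β}_{β ∈ F_q}, indexed through the enumeration Fin q ↔ F_q,
  -- with 0 ≤ ν_β ≤ σ(m,q;β)
  families : ℕ → List (Vec ℕ q)
  families m = bounded (Vec.tabulate (λ i → σ m (to i)))

  Dformula : ℕ → ℕ → ℕ
  Dformula m j =
    sumℕ (List.map
      (λ ν → if does (Vec.sum ν ℕ.≟ j)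
                ∧ isZero (vsum (Vec.zipWith _·_ ν (Vec.tabulate to)))
             then Vec.foldr _ ℕ._*_ 1 (Vec.zipWith (λ i k → σ m (to i) C k) (Vec.allFin q) ν)
             else 0)
      (families m))

module Submission where

-- The trace is additive, F₂-valued and not identically 0, so λ is a nontrivial additive character of F_q and
-- Σ_a λ(a s) detects s = 0.  For a ≠ 0 the codeword (tr (a gᵢ))ᵢ of the dual of D_m has weight
-- ((q - 1)^m - K(λ;a)^m) / 2, because Σ λ(a (α + α⁻¹)) = K(λ;a): substitute α = β² a⁻¹ and use tr x² = tr x.
-- Summing the h-th powers of these weights over a and expressing the sum through D_m is the Pless power
-- moment identity; the recursion follows by the binomial theorem, solving for the top term.  The formula
-- for D_{m,j} groups the coordinates of a codeword by the value of gᵢ.  In the formula for σ, the same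
-- sums Σ_a λ(a β) K(λ;a)^m arise from detecting Σ (αᵢ + αᵢ⁻¹) = β and Σ αᵢ⁻¹ = β.

open import Defs
open import Algebra.Bundles using (CommutativeRing)
open import Algebra.Structures using (IsCommutativeRing; IsCommutativeSemiring)
import Algebra.Solver.Ring.NaturalCoefficients.Default as NatSolver
open import Data.Bool using (Bool; true; false; if_then_else_; _∧_)
open import Data.Fin using (Fin; zero; suc)
open import Data.Fin.Properties using (suc-injective)
open import Data.Integer as ℤ using (ℤ; -[1+_]; 0ℤ; 1ℤ; -1ℤ)
import Data.Integer.Properties as ℤ
import Data.Integer.Tactic.RingSolver as ℤSolver
open import Data.List as List using (List; []; _∷_; _++_; map; foldr; concatMap; upTo; length; allFin)
open import Data.List.Membership.Propositional using (_∈_; find)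
open import Data.List.Membership.Propositional.Properties using (∈-map⁺; ∈-map⁻; ∈-allFin)
open import Data.List.Membership.Propositional.Properties.WithK using (unique∧set⇒bag)
open import Data.List.Properties using (map-upTo; applyUpTo-∷ʳ; map-∘; length-map; length-tabulate)
open import Data.List.Relation.Binary.BagAndSetEquality using (∼bag⇒↭)
open import Data.List.Relation.Binary.Permutation.Propositional using (_↭_; ↭⇒↭ₛ)
open import Data.List.Relation.Binary.Permutation.Propositional.Properties using (map⁺; ↭-length)
open import Data.List.Relation.Binary.Permutation.Setoid.Properties using (foldr-commMonoid)
open import Data.List.Relation.Unary.All as All using (All; []; _∷_; all?)
open import Data.List.Relation.Unary.All.Properties using (¬All⇒Any¬)
open import Data.List.Relation.Unary.AllPairs using ([]; _∷_)
open import Data.List.Relation.Unary.Any using (here; there)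
open import Data.List.Relation.Unary.Unique.Propositional using (Unique)
import Data.List.Relation.Unary.Unique.Propositional.Properties as Unique
open import Data.Nat as ℕ using (ℕ; zero; suc; _∸_; _<_; _≤_; z≤n; s≤s; _⊓_; _!)
open import Data.Nat.Combinatorics using (_C_; nCk+nC[k+1]≡[n+1]C[k+1]; k>n⇒nCk≡0; nCk≡nC[n∸k]; nCn≡1)
open import Data.Nat.Divisibility using (_∣_; ∣-refl; ∣m∣n⇒∣m+n; *-pres-∣; ∣n⇒∣m*n; _∣0)
open import Data.Nat.DivMod using (m/n*n≡m)
import Data.Nat.Properties as ℕ
import Data.Nat.Tactic.RingSolver as ℕSolver
open import Data.Product using (∃; _×_; _,_; proj₁; proj₂)
open import Data.Sum using (_⊎_; inj₁; inj₂)
open import Data.Vec as Vec using (Vec; []; _∷_)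
open import Function using (_∘_; id; mk⇔)
open import Function.Bundles using (Inverse)
open import Level using (0ℓ)
open import Relation.Binary.PropositionalEquality using (_≡_; _≢_; refl; sym; trans; cong; cong₂; subst; setoid; module ≡-Reasoning)
open import Relation.Nullary using (does; yes; no; contradiction)
open import Relation.Nullary.Decidable using (dec-true; dec-false)
open ≡-Reasoning

-- The Pless identity comes from a generating function. If c is the weight of the trace word of a,
-- then (1 + 2y)^c = Π (1 + y - λ(a gᵢ) y), and choosing 1 + y or -λ(a gᵢ) y in each factor gives
-- the sum of λ(a Σ uᵢ gᵢ) (-y)^w (1 + y)^(n - w) over the binary words u of weight w. Since c^h = Σ
-- t! S(h,t) C(c,t), the power (2c)^h combines the coefficients 2^t C(c,t) with factors t! S(h,t)
-- 2^(h - t): this is where the powers of 2 in the recursion come from. The term a = 0 is 0^h and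
-- disappears because h ≥ 1. Only the ring axioms, inverses and the number of elements of F are
-- given. Characteristic 2, x^q = x, square roots and an element of nonzero trace must be obtained
-- from permutations of F and from a bound on the number of roots of a polynomial. Weights are
-- doubled and σ is multiplied by q throughout, which keeps every identity in ℤ.

unique∧⊆∧⊇⇒↭ : {A : Set} {xs ys : List A} → Unique xs → Unique ys →
  (∀ {z} → z ∈ xs → z ∈ ys) → (∀ {z} → z ∈ ys → z ∈ xs) → xs ↭ ys
unique∧⊆∧⊇⇒↭ uxs uys ⊆ ⊇ = ∼bag⇒↭ (unique∧set⇒bag uxs uys (mk⇔ ⊆ ⊇))

-- Finite sums in a commutative semiring, and Pascal's rule under the summation sign.

module Sum {A : Set} {add mul : A → A → A} {0# 1# : A}
           (isCommutativeSemiring : IsCommutativeSemiring _≡_ add mul 0# 1#) where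
  open IsCommutativeSemiring isCommutativeSemiring
    using (+-assoc; +-comm; +-identityˡ; +-identityʳ; distribˡ; distribʳ; *-comm; zeroˡ; zeroʳ; +-isCommutativeMonoid)

  private
    infixl 6 _+_
    infixl 7 _*_
    _+_ _*_ : A → A → A
    _+_ = add
    _*_ = mul

  -- Built from `foldr` and `map` so that `sumℕ`, `sumℤ` and `Σ*` applied to a mapped list, and also
  -- `tr` as a sum in F, unfold to it definitionally.
  ∑ : {X : Set} → List X → (X → A) → A
  ∑ xs f = foldr _+_ 0# (map f xs)

  ∑< : ℕ → (ℕ → A) → A
  ∑< n = ∑ (upTo n)

  +-interchange : ∀ a b c d → (a + b) + (c + d) ≡ (a + c) + (b + d)
  +-interchange a b c d = begin
    (a + b) + (c + d) ≡⟨ +-assoc a b (c + d) ⟩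
    a + (b + (c + d)) ≡⟨ cong (a +_) (+-assoc b c d) ⟨
    a + ((b + c) + d) ≡⟨ cong (λ z → a + (z + d)) (+-comm b c) ⟩
    a + ((c + b) + d) ≡⟨ cong (a +_) (+-assoc c b d) ⟩
    a + (c + (b + d)) ≡⟨ +-assoc a c (b + d) ⟨
    (a + c) + (b + d) ∎

  module _ {X : Set} where

    ∑-cong∈ : (xs : List X) {f g : X → A} → (∀ {x} → x ∈ xs → f x ≡ g x) → ∑ xs f ≡ ∑ xs g
    ∑-cong∈ []       eq = refl
    ∑-cong∈ (x ∷ xs) eq = cong₂ _+_ (eq (here refl)) (∑-cong∈ xs (eq ∘ there))

    ∑-cong : (xs : List X) {f g : X → A} → (∀ x → f x ≡ g x) → ∑ xs f ≡ ∑ xs g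
    ∑-cong xs eq = ∑-cong∈ xs (λ {x} _ → eq x)

    ∑-zero : (xs : List X) → ∑ xs (λ _ → 0#) ≡ 0#
    ∑-zero []       = refl
    ∑-zero (x ∷ xs) = trans (+-identityˡ _) (∑-zero xs)

    ∑-+ : (xs : List X) (f g : X → A) → ∑ xs (λ x → f x + g x) ≡ ∑ xs f + ∑ xs g
    ∑-+ []       f g = sym (+-identityˡ 0#)
    ∑-+ (x ∷ xs) f g = trans (cong ((f x + g x) +_) (∑-+ xs f g)) (+-interchange (f x) (g x) _ _)

    *-∑ : (xs : List X) (c : A) (f : X → A) → ∑ xs (λ x → c * f x) ≡ c * ∑ xs f
    *-∑ []       c f = sym (zeroʳ c)
    *-∑ (x ∷ xs) c f = trans (cong ((c * f x) +_) (*-∑ xs c f)) (sym (distribˡ c (f x) _))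

    ∑-* : (xs : List X) (f : X → A) (c : A) → ∑ xs (λ x → f x * c) ≡ ∑ xs f * c
    ∑-* xs f c = trans (∑-cong xs (λ x → *-comm (f x) c)) (trans (*-∑ xs c f) (*-comm c _))

    ∑-++ : (xs ys : List X) (f : X → A) → ∑ (xs ++ ys) f ≡ ∑ xs f + ∑ ys f
    ∑-++ []       ys f = sym (+-identityˡ _)
    ∑-++ (x ∷ xs) ys f = trans (cong (f x +_) (∑-++ xs ys f)) (sym (+-assoc (f x) _ _))

    ∑-↭ : {xs ys : List X} (f : X → A) → xs ↭ ys → ∑ xs f ≡ ∑ ys f
    ∑-↭ f p = foldr-commMonoid (setoid A) +-isCommutativeMonoid (↭⇒↭ₛ (map⁺ f p))

  module _ {X Y : Set} where

    ∑-swap : (xs : List X) (ys : List Y) (f : X → Y → A) →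
      ∑ xs (λ x → ∑ ys (f x)) ≡ ∑ ys (λ y → ∑ xs (λ x → f x y))
    ∑-swap []       ys f = sym (∑-zero ys)
    ∑-swap (x ∷ xs) ys f = trans (cong (∑ ys (f x) +_) (∑-swap xs ys f)) (sym (∑-+ ys (f x) _))

    ∑-map : (xs : List X) (g : X → Y) (f : Y → A) → ∑ (map g xs) f ≡ ∑ xs (f ∘ g)
    ∑-map xs g f = cong (foldr _+_ 0#) (sym (map-∘ xs))

    ∑-concatMap : (xs : List X) (k : X → List Y) (f : Y → A) →
      ∑ (concatMap k xs) f ≡ ∑ xs (λ x → ∑ (k x) f)
    ∑-concatMap []       k f = refl
    ∑-concatMap (x ∷ xs) k f = trans (∑-++ (k x) _ f) (cong (∑ (k x) f +_) (∑-concatMap xs k f))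

  ∑-product : {X Y Z : Set} (xs : List X) (ys : List Y) (g : X → Y → Z) (f : Z → A) →
    ∑ (concatMap (λ x → map (g x) ys) xs) f ≡ ∑ xs (λ x → ∑ ys (λ y → f (g x y)))
  ∑-product xs ys g f = trans (∑-concatMap xs _ f) (∑-cong xs (λ x → ∑-map ys (g x) f))

  ∑<-suc : ∀ n f → ∑< (suc n) f ≡ f 0 + ∑< n (f ∘ suc)
  ∑<-suc n f = cong (λ l → f 0 + foldr _+_ 0# l)
    (trans (cong (map f) (sym (map-upTo suc n))) (sym (map-∘ (upTo n))))

  ∑<-last : ∀ n f → ∑< (suc n) f ≡ ∑< n f + f n
  ∑<-last n f = begin
    ∑< (suc n) f            ≡⟨ cong (λ l → ∑ l f) (applyUpTo-∷ʳ id n) ⟨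
    ∑ (upTo n ++ n ∷ []) f  ≡⟨ ∑-++ (upTo n) (n ∷ []) f ⟩
    ∑< n f + (f n + 0#)     ≡⟨ cong (∑< n f +_) (+-identityʳ (f n)) ⟩
    ∑< n f + f n            ∎

  ∑<-cong : ∀ n {f g : ℕ → A} → (∀ k → k < n → f k ≡ g k) → ∑< n f ≡ ∑< n g
  ∑<-cong zero    eq = refl
  ∑<-cong (suc n) {f} {g} eq = begin
    ∑< (suc n) f              ≡⟨ ∑<-suc n f ⟩
    f 0 + ∑< n (f ∘ suc)      ≡⟨ cong₂ _+_ (eq 0 (s≤s z≤n)) (∑<-cong n (λ k k<n → eq (suc k) (s≤s k<n))) ⟩
    g 0 + ∑< n (g ∘ suc)      ≡⟨ ∑<-suc n g ⟨
    ∑< (suc n) g              ∎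

  ∑<-drop : ∀ a n f → (∀ k → k < a → f k ≡ 0#) → ∑< n f ≡ ∑< (n ∸ a) (f ∘ (a ℕ.+_))
  ∑<-drop zero    n       f f≡0 = refl
  ∑<-drop (suc a) zero    f f≡0 = refl
  ∑<-drop (suc a) (suc n) f f≡0 = begin
    ∑< (suc n) f                  ≡⟨ ∑<-suc n f ⟩
    f 0 + ∑< n (f ∘ suc)          ≡⟨ cong (_+ ∑< n (f ∘ suc)) (f≡0 0 (s≤s z≤n)) ⟩
    0# + ∑< n (f ∘ suc)           ≡⟨ +-identityˡ _ ⟩
    ∑< n (f ∘ suc)                ≡⟨ ∑<-drop a n (f ∘ suc) (λ k k<a → f≡0 (suc k) (s≤s k<a)) ⟩
    ∑< (n ∸ a) (f ∘ (suc a ℕ.+_)) ∎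

  ∑-range : ∀ a b f → ∑ (range a b) f ≡ ∑< (suc b ∸ a) (f ∘ (a ℕ.+_))
  ∑-range a b f = ∑-map (upTo (suc b ∸ a)) (a ℕ.+_) f

  ∑<-indicator : ∀ n k (f : ℕ → A) → k < n → ∑< n (λ j → if does (k ℕ.≟ j) then f j else 0#) ≡ f k
  ∑<-indicator (suc n) zero    f _ = begin
    ∑< (suc n) (λ j → if does (0 ℕ.≟ j) then f j else 0#) ≡⟨ ∑<-suc n _ ⟩
    f 0 + ∑< n (λ j → 0#)                                 ≡⟨ cong (f 0 +_) (∑-zero (upTo n)) ⟩
    f 0 + 0#                                              ≡⟨ +-identityʳ _ ⟩
    f 0                                                   ∎
  ∑<-indicator (suc n) (suc k) f (s≤s k<n) = begin
    ∑< (suc n) (λ j → if does (suc k ℕ.≟ j) then f j else 0#)        ≡⟨ ∑<-suc n _ ⟩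
    0# + ∑< n (λ j → if does (suc k ℕ.≟ suc j) then f (suc j) else 0#) ≡⟨ +-identityˡ _ ⟩
    ∑< n (λ j → if does (suc k ℕ.≟ suc j) then f (suc j) else 0#)    ≡⟨⟩
    ∑< n (λ j → if does (k ℕ.≟ j) then f (suc j) else 0#)            ≡⟨ ∑<-indicator n k (f ∘ suc) k<n ⟩
    f (suc k)                                                        ∎

  -- Pascal's rule moves from the binomial coefficients to the summand. The additive map `ι` embeds
  -- the coefficients, so one proof serves ℤ (binomial theorem, finite differences) and ℕ (codeword
  -- counts).
  ∑<-pascal : (ι : ℕ → A) → ι 0 ≡ 0# → (∀ m n → ι (m ℕ.+ n) ≡ ι m + ι n) → ∀ b (f : ℕ → A) →
    ∑< (2 ℕ.+ b) (λ k → ι (suc b C k) * f k) ≡ ∑< (suc b) (λ k → ι (b C k) * (f k + f (suc k)))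
  ∑<-pascal ι ι-0 ι-+ b f = begin
    ∑< (2 ℕ.+ b) (λ k → ι (suc b C k) * f k)
      ≡⟨ ∑<-suc (suc b) _ ⟩
    ι 1 * f 0 + ∑< (suc b) (λ k → ι (suc b C suc k) * f (suc k))
      ≡⟨ cong (ι 1 * f 0 +_) (trans (∑-cong (upTo (suc b)) split) (∑-+ (upTo (suc b)) _ _)) ⟩
    ι 1 * f 0 + (∑< (suc b) (λ k → ι (b C k) * f (suc k)) + ∑< (suc b) (λ k → ι (b C suc k) * f (suc k)))
      ≡⟨ cong (ι 1 * f 0 +_) (+-comm _ _) ⟩
    ι 1 * f 0 + (∑< (suc b) (λ k → ι (b C suc k) * f (suc k)) + ∑< (suc b) (λ k → ι (b C k) * f (suc k)))
      ≡⟨ +-assoc _ _ _ ⟨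
    (ι 1 * f 0 + ∑< (suc b) (λ k → ι (b C suc k) * f (suc k))) + ∑< (suc b) (λ k → ι (b C k) * f (suc k))
      ≡⟨ cong (_+ ∑< (suc b) (λ k → ι (b C k) * f (suc k))) head ⟩
    ∑< (suc b) (λ k → ι (b C k) * f k) + ∑< (suc b) (λ k → ι (b C k) * f (suc k))
      ≡⟨ ∑-+ (upTo (suc b)) _ _ ⟨
    ∑< (suc b) (λ k → ι (b C k) * f k + ι (b C k) * f (suc k))
      ≡⟨ ∑-cong (upTo (suc b)) (λ k → sym (distribˡ (ι (b C k)) (f k) (f (suc k)))) ⟩
    ∑< (suc b) (λ k → ι (b C k) * (f k + f (suc k))) ∎
    where
    split : ∀ k → ι (suc b C suc k) * f (suc k) ≡ ι (b C k) * f (suc k) + ι (b C suc k) * f (suc k)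
    split k = begin
      ι (suc b C suc k) * f (suc k)                 ≡⟨ cong (λ c → ι c * f (suc k)) (nCk+nC[k+1]≡[n+1]C[k+1] b k) ⟨
      ι (b C k ℕ.+ b C suc k) * f (suc k)           ≡⟨ cong (_* f (suc k)) (ι-+ (b C k) (b C suc k)) ⟩
      (ι (b C k) + ι (b C suc k)) * f (suc k)       ≡⟨ distribʳ (f (suc k)) _ _ ⟩
      ι (b C k) * f (suc k) + ι (b C suc k) * f (suc k) ∎
    -- Both sides are the sum that includes the index `suc b`, whose coefficient `b C suc b` is 0.
    head : ι 1 * f 0 + ∑< (suc b) (λ k → ι (b C suc k) * f (suc k)) ≡ ∑< (suc b) (λ k → ι (b C k) * f k)
    head = begin
      ι 1 * f 0 + ∑< (suc b) (λ k → ι (b C suc k) * f (suc k)) ≡⟨ ∑<-suc (suc b) (λ k → ι (b C k) * f k) ⟨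
      ∑< (2 ℕ.+ b) (λ k → ι (b C k) * f k)                     ≡⟨ ∑<-last (suc b) _ ⟩
      ∑< (suc b) (λ k → ι (b C k) * f k) + ι (b C suc b) * f (suc b)
        ≡⟨ cong (λ c → ∑< (suc b) (λ k → ι (b C k) * f k) + ι c * f (suc b)) (k>n⇒nCk≡0 (ℕ.n<1+n b)) ⟩
      ∑< (suc b) (λ k → ι (b C k) * f k) + ι 0 * f (suc b)
        ≡⟨ cong (λ c → ∑< (suc b) (λ k → ι (b C k) * f k) + c * f (suc b)) ι-0 ⟩
      ∑< (suc b) (λ k → ι (b C k) * f k) + 0# * f (suc b)      ≡⟨ cong (∑< (suc b) (λ k → ι (b C k) * f k) +_) (zeroˡ _) ⟩
      ∑< (suc b) (λ k → ι (b C k) * f k) + 0#                  ≡⟨ +-identityʳ _ ⟩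
      ∑< (suc b) (λ k → ι (b C k) * f k)                       ∎

module ∑ℕ = Sum ℕ.+-*-isCommutativeSemiring
module ∑ℤ = Sum ℤ.+-*-isCommutativeSemiring

-- Binomial coefficients, surjection numbers and finite differences.

module IntegerSums where
  open import Data.Integer using (+_; _+_; _*_; _^_; -_; _-_)
  open ∑ℤ

  pos-∑ : {X : Set} (xs : List X) (f : X → ℕ) → + ∑ℕ.∑ xs f ≡ ∑ xs (λ x → + f x)
  pos-∑ []       f = refl
  pos-∑ (x ∷ xs) f = trans (ℤ.pos-+ (f x) (∑ℕ.∑ xs f)) (cong (λ z → + f x + z) (pos-∑ xs f))

  ∑-1 : {X : Set} (xs : List X) → ∑ xs (λ _ → 1ℤ) ≡ + length xs
  ∑-1 []       = refl
  ∑-1 (x ∷ xs) = cong (λ z → 1ℤ + z) (∑-1 xs)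

  pos-^ : ∀ m n → + (m ℕ.^ n) ≡ (+ m) ^ n
  pos-^ m zero    = refl
  pos-^ m (suc n) = trans (ℤ.pos-* m (m ℕ.^ n)) (cong (λ z → + m * z) (pos-^ m n))

  1+n∸k : ∀ {n k} → k < suc n → suc n ∸ k ≡ suc (n ∸ k)
  1+n∸k (s≤s k≤n) = ℕ.+-∸-assoc 1 k≤n

  binomial-theorem : ∀ x y h → (x + y) ^ h ≡ ∑< (suc h) (λ k → + (h C k) * (x ^ k * y ^ (h ∸ k)))
  binomial-theorem x y zero    = refl
  binomial-theorem x y (suc h) = begin
    (x + y) * (x + y) ^ h
      ≡⟨ cong ((x + y) *_) (binomial-theorem x y h) ⟩
    (x + y) * ∑< (suc h) (λ k → + (h C k) * (x ^ k * y ^ (h ∸ k)))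
      ≡⟨ *-∑ (upTo (suc h)) (x + y) (λ k → + (h C k) * (x ^ k * y ^ (h ∸ k))) ⟨
    ∑< (suc h) (λ k → (x + y) * (+ (h C k) * (x ^ k * y ^ (h ∸ k))))
      ≡⟨ ∑<-cong (suc h) step ⟩
    ∑< (suc h) (λ k → + (h C k) * (x ^ k * y ^ (suc h ∸ k) + x ^ suc k * y ^ (h ∸ k)))
      ≡⟨ ∑<-pascal +_ refl ℤ.pos-+ h (λ k → x ^ k * y ^ (suc h ∸ k)) ⟨
    ∑< (2 ℕ.+ h) (λ k → + (suc h C k) * (x ^ k * y ^ (suc h ∸ k))) ∎
    where
    rearrange : ∀ x y c a b → (x + y) * (c * (a * b)) ≡ c * (a * (y * b) + (x * a) * b)
    rearrange = ℤSolver.solve-∀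
    step : ∀ k → k < suc h → (x + y) * (+ (h C k) * (x ^ k * y ^ (h ∸ k)))
      ≡ + (h C k) * (x ^ k * y ^ (suc h ∸ k) + x ^ suc k * y ^ (h ∸ k))
    step k k≤h = trans (rearrange x y (+ (h C k)) (x ^ k) (y ^ (h ∸ k)))
      (cong (λ e → + (h C k) * (x ^ k * y ^ e + x ^ suc k * y ^ (h ∸ k))) (sym (1+n∸k k≤h)))

  -- Both sides count the (k+1)-subsets of an (n+1)-set with one marked element. The induction on
  -- Pascal's rule avoids division by factorials.
  C-absorption : ∀ n k → suc k ℕ.* (suc n C suc k) ≡ suc n ℕ.* (n C k)
  C-absorption zero    zero    = refl
  C-absorption zero    (suc k) = trans (cong (suc (suc k) ℕ.*_) (k>n⇒nCk≡0 {1} {2 ℕ.+ k} (s≤s (s≤s z≤n))))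
    (trans (ℕ.*-zeroʳ (suc (suc k))) (cong (1 ℕ.*_) (sym (k>n⇒nCk≡0 {0} {suc k} (s≤s z≤n)))))
  C-absorption (suc n) zero    = begin
    1 ℕ.* (suc (suc n) C 1)               ≡⟨ cong (1 ℕ.*_) (nCk+nC[k+1]≡[n+1]C[k+1] (suc n) 0) ⟨
    1 ℕ.* (1 ℕ.+ suc n C 1)               ≡⟨ rearrange (suc n C 1) ⟩
    1 ℕ.+ 1 ℕ.* (suc n C 1)               ≡⟨ cong suc (C-absorption n 0) ⟩
    1 ℕ.+ suc n ℕ.* 1                     ∎
    where
    rearrange : ∀ c → 1 ℕ.* (1 ℕ.+ c) ≡ 1 ℕ.+ 1 ℕ.* c
    rearrange = ℕSolver.solve-∀
  C-absorption (suc n) (suc k) = begin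
    suc (suc k) ℕ.* (suc (suc n) C suc (suc k))
      ≡⟨ cong (suc (suc k) ℕ.*_) (nCk+nC[k+1]≡[n+1]C[k+1] (suc n) (suc k)) ⟨
    suc (suc k) ℕ.* (c ℕ.+ suc n C suc (suc k))
      ≡⟨ expand k c (suc n C suc (suc k)) ⟩
    c ℕ.+ (suc k ℕ.* c ℕ.+ suc (suc k) ℕ.* (suc n C suc (suc k)))
      ≡⟨ cong (c ℕ.+_) (cong₂ ℕ._+_ (C-absorption n k) (C-absorption n (suc k))) ⟩
    c ℕ.+ (suc n ℕ.* (n C k) ℕ.+ suc n ℕ.* (n C suc k))
      ≡⟨ cong (c ℕ.+_) (ℕ.*-distribˡ-+ (suc n) (n C k) (n C suc k)) ⟨
    c ℕ.+ suc n ℕ.* (n C k ℕ.+ n C suc k)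
      ≡⟨ cong (λ z → c ℕ.+ suc n ℕ.* z) (nCk+nC[k+1]≡[n+1]C[k+1] n k) ⟩
    suc (suc n) ℕ.* c ∎
    where
    c = suc n C suc k
    expand : ∀ k c d → suc (suc k) ℕ.* (c ℕ.+ d) ≡ c ℕ.+ (suc k ℕ.* c ℕ.+ suc (suc k) ℕ.* d)
    expand = ℕSolver.solve-∀

  -- An element paired with a k-subset either lies in it or enlarges it to a (k+1)-subset with a
  -- marked element. This is multiplication by n in the basis of binomial polynomials.
  n*nCk : ∀ n k → n ℕ.* (n C k) ≡ k ℕ.* (n C k) ℕ.+ suc k ℕ.* (n C suc k)
  n*nCk n k = ℕ.+-cancelˡ-≡ (n C k) _ _ (begin
    suc n ℕ.* (n C k)                                            ≡⟨ C-absorption n k ⟨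
    suc k ℕ.* (suc n C suc k)                                    ≡⟨ cong (suc k ℕ.*_) (nCk+nC[k+1]≡[n+1]C[k+1] n k) ⟨
    suc k ℕ.* (n C k ℕ.+ n C suc k)                              ≡⟨ rearrange k (n C k) (n C suc k) ⟩
    n C k ℕ.+ (k ℕ.* (n C k) ℕ.+ suc k ℕ.* (n C suc k))          ∎)
    where
    rearrange : ∀ k c d → suc k ℕ.* (c ℕ.+ d) ≡ c ℕ.+ (k ℕ.* c ℕ.+ suc k ℕ.* d)
    rearrange = ℕSolver.solve-∀

  -- Absorption rearranged for `Δ-*`: it replaces a factor k by a difference of two binomial
  -- coefficients, with the subtraction moved to the other side to remain in ℕ.
  k*[1+n]Ck : ∀ n k → k ℕ.* (suc n C k) ℕ.+ suc n ℕ.* (n C k) ≡ suc n ℕ.* (suc n C k)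
  k*[1+n]Ck n zero    = refl
  k*[1+n]Ck n (suc k) = begin
    suc k ℕ.* (suc n C suc k) ℕ.+ suc n ℕ.* (n C suc k) ≡⟨ cong (ℕ._+ suc n ℕ.* (n C suc k)) (C-absorption n k) ⟩
    suc n ℕ.* (n C k) ℕ.+ suc n ℕ.* (n C suc k)         ≡⟨ ℕ.*-distribˡ-+ (suc n) (n C k) (n C suc k) ⟨
    suc n ℕ.* (n C k ℕ.+ n C suc k)                     ≡⟨ cong (suc n ℕ.*_) (nCk+nC[k+1]≡[n+1]C[k+1] n k) ⟩
    suc n ℕ.* (suc n C suc k)                           ∎

  -- surj h t = t! S(h,t) counts the surjections from an h-set onto a t-set.
  surj : ℕ → ℕ → ℕ
  surj zero    zero    = 1
  surj zero    (suc t) = 0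
  surj (suc h) zero    = 0
  surj (suc h) (suc t) = suc t ℕ.* (surj h (suc t) ℕ.+ surj h t)

  h<t⇒surj≡0 : ∀ h t → h < t → surj h t ≡ 0
  h<t⇒surj≡0 zero    (suc t) _         = refl
  h<t⇒surj≡0 (suc h) (suc t) (s≤s h<t)
    rewrite h<t⇒surj≡0 h (suc t) (ℕ.m<n⇒m<1+n h<t) | h<t⇒surj≡0 h t h<t = ℕ.*-zeroʳ t

  -- Makes the division by t! in `S` exact. In the recursion the factor `suc t` completes t! to
  -- (t+1)! in the second summand; the first is already divisible.
  t!∣surj : ∀ h t → t ! ∣ surj h t
  t!∣surj zero    zero    = ∣-refl
  t!∣surj zero    (suc t) = (suc t !) ∣0
  t!∣surj (suc h) zero    = 1 ∣0
  t!∣surj (suc h) (suc t) = subst (suc t ! ∣_) (sym (ℕ.*-distribˡ-+ (suc t) (surj h (suc t)) (surj h t)))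
    (∣m∣n⇒∣m+n (∣n⇒∣m*n (suc t) (t!∣surj h (suc t))) (*-pres-∣ (∣-refl {suc t}) (t!∣surj h t)))

  -- Functions from an h-set to an x-set are sorted by their image. In the induction, multiplication
  -- by x sends C(x,t) to t C(x,t) + (t+1) C(x,t+1), and collecting coefficients reproduces the
  -- recursion of `surj`.
  ^-surj : ∀ x h → x ℕ.^ h ≡ ∑ℕ.∑< (suc h) (λ t → surj h t ℕ.* (x C t))
  ^-surj x zero    = refl
  ^-surj x (suc h) = begin
    x ℕ.* x ℕ.^ h
      ≡⟨ cong (x ℕ.*_) (^-surj x h) ⟩
    x ℕ.* ∑ℕ.∑< (suc h) (λ t → surj h t ℕ.* (x C t))
      ≡⟨ ∑ℕ.*-∑ (upTo (suc h)) x (λ t → surj h t ℕ.* (x C t)) ⟨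
    ∑ℕ.∑< (suc h) (λ t → x ℕ.* (surj h t ℕ.* (x C t)))
      ≡⟨ ∑ℕ.∑-cong (upTo (suc h)) split ⟩
    ∑ℕ.∑< (suc h) (λ t → f t ℕ.+ g t)
      ≡⟨ ∑ℕ.∑-+ (upTo (suc h)) f g ⟩
    ∑ℕ.∑< (suc h) f ℕ.+ ∑ℕ.∑< (suc h) g
      ≡⟨ cong (ℕ._+ ∑ℕ.∑< (suc h) g) shift ⟩
    ∑ℕ.∑< (suc h) (f ∘ suc) ℕ.+ ∑ℕ.∑< (suc h) g
      ≡⟨ ∑ℕ.∑-+ (upTo (suc h)) (f ∘ suc) g ⟨
    ∑ℕ.∑< (suc h) (λ t → f (suc t) ℕ.+ g t)
      ≡⟨ ∑ℕ.∑-cong (upTo (suc h)) (λ t → join (suc t) (surj h (suc t)) (surj h t) (x C suc t)) ⟩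
    ∑ℕ.∑< (suc h) (λ t → surj (suc h) (suc t) ℕ.* (x C suc t))
      ≡⟨ ∑ℕ.∑<-suc (suc h) (λ t → surj (suc h) t ℕ.* (x C t)) ⟨
    ∑ℕ.∑< (2 ℕ.+ h) (λ t → surj (suc h) t ℕ.* (x C t)) ∎
    where
    f g : ℕ → ℕ
    f t = t ℕ.* surj h t ℕ.* (x C t)
    g t = suc t ℕ.* surj h t ℕ.* (x C suc t)
    expand : ∀ t s c d → s ℕ.* (t ℕ.* c ℕ.+ suc t ℕ.* d) ≡ t ℕ.* s ℕ.* c ℕ.+ suc t ℕ.* s ℕ.* d
    expand = ℕSolver.solve-∀
    comm : ∀ x s c → x ℕ.* (s ℕ.* c) ≡ s ℕ.* (x ℕ.* c)
    comm = ℕSolver.solve-∀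
    join : ∀ t s s' d → t ℕ.* s ℕ.* d ℕ.+ t ℕ.* s' ℕ.* d ≡ t ℕ.* (s ℕ.+ s') ℕ.* d
    join = ℕSolver.solve-∀
    split : ∀ t → x ℕ.* (surj h t ℕ.* (x C t)) ≡ f t ℕ.+ g t
    split t = begin
      x ℕ.* (surj h t ℕ.* (x C t))                               ≡⟨ comm x (surj h t) (x C t) ⟩
      surj h t ℕ.* (x ℕ.* (x C t))                               ≡⟨ cong (surj h t ℕ.*_) (n*nCk x t) ⟩
      surj h t ℕ.* (t ℕ.* (x C t) ℕ.+ suc t ℕ.* (x C suc t))     ≡⟨ expand t (surj h t) (x C t) (x C suc t) ⟩
      f t ℕ.+ g t                                                ∎
    -- The sum can be shifted by one index because both ends vanish: f 0 has the factor 0, and f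
    -- (h+1) contains `surj h (suc h)`.
    shift : ∑ℕ.∑< (suc h) f ≡ ∑ℕ.∑< (suc h) (f ∘ suc)
    shift = begin
      ∑ℕ.∑< (suc h) f                       ≡⟨ ∑ℕ.∑<-suc h f ⟩
      ∑ℕ.∑< h (f ∘ suc)                     ≡⟨ ℕ.+-identityʳ _ ⟨
      ∑ℕ.∑< h (f ∘ suc) ℕ.+ 0               ≡⟨ cong (∑ℕ.∑< h (f ∘ suc) ℕ.+_) top ⟨
      ∑ℕ.∑< h (f ∘ suc) ℕ.+ f (suc h)       ≡⟨ ∑ℕ.∑<-last h (f ∘ suc) ⟨
      ∑ℕ.∑< (suc h) (f ∘ suc)               ∎
      where
      top : f (suc h) ≡ 0
      top = trans (cong (λ s → suc h ℕ.* s ℕ.* (x C suc h)) (h<t⇒surj≡0 h (suc h) ℕ.≤-refl))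
        (cong (ℕ._* (x C suc h)) (ℕ.*-zeroʳ (suc h)))

  -- The t-th forward difference of `f` at 0. For f j = j^h it is the numerator in the definition of
  -- `S h t`.
  Δ : ℕ → (ℕ → ℤ) → ℤ
  Δ t f = ∑< (suc t) (λ j → + (t C j) * (sign (t ∸ j) * f j))

  sign-suc-∸ : ∀ {t j} → j < suc t → sign (suc t ∸ j) ≡ - sign (t ∸ j)
  sign-suc-∸ {t} {j} j≤t = trans (cong sign (1+n∸k j≤t)) (ℤ.-1*i≡-i (sign (t ∸ j)))

  Δ-cong : ∀ t {f g} → (∀ j → f j ≡ g j) → Δ t f ≡ Δ t g
  Δ-cong t eq = ∑-cong (upTo (suc t)) (λ j → cong (λ z → + (t C j) * (sign (t ∸ j) * z)) (eq j))

  -- Pascal's rule pairs f j with f (j+1) under opposite signs. It settles h = 0 in `Δ-^`, where the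
  -- first difference of a constant is 0.
  Δ-suc : ∀ t f → Δ (suc t) f ≡ Δ t (λ j → f (suc j) + - f j)
  Δ-suc t f = trans (∑<-pascal +_ refl ℤ.pos-+ t (λ j → sign (suc t ∸ j) * f j)) (∑<-cong (suc t) step)
    where
    rearrange : ∀ c s a b → c * (- s * a + s * b) ≡ c * (s * (b + - a))
    rearrange = ℤSolver.solve-∀
    step : ∀ j → j < suc t → + (t C j) * (sign (suc t ∸ j) * f j + sign (t ∸ j) * f (suc j))
      ≡ + (t C j) * (sign (t ∸ j) * (f (suc j) + - f j))
    step j j≤t = trans (cong (λ s → + (t C j) * (s * f j + sign (t ∸ j) * f (suc j))) (sign-suc-∸ j≤t))
      (rearrange (+ (t C j)) (sign (t ∸ j)) (f j) (f (suc j)))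

  Δ-zero : ∀ t → Δ t (λ _ → 0ℤ) ≡ 0ℤ
  Δ-zero t = trans (∑-cong (upTo (suc t)) (λ j → trans (cong (+ (t C j) *_) (ℤ.*-zeroʳ (sign (t ∸ j)))) (ℤ.*-zeroʳ (+ (t C j)))))
    (∑-zero (upTo (suc t)))

  -- The Leibniz rule for the product with the identity function, evaluated at 0. The factor j is
  -- absorbed into the binomial coefficient, and the outcome has the shape of the recursion of
  -- `surj`.
  Δ-* : ∀ t f → Δ (suc t) (λ j → + j * f j) ≡ + suc t * (Δ (suc t) f + Δ t f)
  Δ-* t f = begin
    ∑< (2 ℕ.+ t) (λ j → + (suc t C j) * (s j * (+ j * f j)))
      ≡⟨ ∑-cong (upTo (2 ℕ.+ t)) step ⟩
    ∑< (2 ℕ.+ t) (λ j → + suc t * (+ (suc t C j) * (s j * f j)) + + suc t * (+ (t C j) * (- s j * f j)))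
      ≡⟨ ∑-+ (upTo (2 ℕ.+ t)) (λ j → + suc t * (+ (suc t C j) * (s j * f j))) (λ j → + suc t * (+ (t C j) * (- s j * f j))) ⟩
    ∑< (2 ℕ.+ t) (λ j → + suc t * (+ (suc t C j) * (s j * f j)))
      + ∑< (2 ℕ.+ t) (λ j → + suc t * (+ (t C j) * (- s j * f j)))
      ≡⟨ cong₂ _+_ (*-∑ (upTo (2 ℕ.+ t)) (+ suc t) (λ j → + (suc t C j) * (s j * f j)))
                   (*-∑ (upTo (2 ℕ.+ t)) (+ suc t) (λ j → + (t C j) * (- s j * f j))) ⟩
    + suc t * Δ (suc t) f + + suc t * ∑< (2 ℕ.+ t) (λ j → + (t C j) * (- s j * f j))
      ≡⟨ cong (λ z → + suc t * Δ (suc t) f + + suc t * z) lower ⟩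
    + suc t * Δ (suc t) f + + suc t * Δ t f
      ≡⟨ ℤ.*-distribˡ-+ (+ suc t) (Δ (suc t) f) (Δ t f) ⟨
    + suc t * (Δ (suc t) f + Δ t f) ∎
    where
    s : ℕ → ℤ
    s j = sign (suc t ∸ j)
    rearrange₁ : ∀ c σ j f d → c * (σ * (j * f)) ≡ (j * c + d) * (σ * f) + d * (- σ * f)
    rearrange₁ = ℤSolver.solve-∀
    rearrange₂ : ∀ n c d σ f → (n * c) * (σ * f) + (n * d) * (- σ * f) ≡ n * (c * (σ * f)) + n * (d * (- σ * f))
    rearrange₂ = ℤSolver.solve-∀
    absorb : ∀ j → + j * + (suc t C j) + + suc t * + (t C j) ≡ + suc t * + (suc t C j)
    absorb j = begin
      + j * + (suc t C j) + + suc t * + (t C j)             ≡⟨ cong₂ _+_ (ℤ.pos-* j (suc t C j)) (ℤ.pos-* (suc t) (t C j)) ⟨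
      + (j ℕ.* (suc t C j) ℕ.+ suc t ℕ.* (t C j))           ≡⟨ cong +_ (k*[1+n]Ck t j) ⟩
      + (suc t ℕ.* (suc t C j))                             ≡⟨ ℤ.pos-* (suc t) (suc t C j) ⟩
      + suc t * + (suc t C j)                               ∎
    step : ∀ j → + (suc t C j) * (s j * (+ j * f j))
      ≡ + suc t * (+ (suc t C j) * (s j * f j)) + + suc t * (+ (t C j) * (- s j * f j))
    step j = begin
      + (suc t C j) * (s j * (+ j * f j))
        ≡⟨ rearrange₁ (+ (suc t C j)) (s j) (+ j) (f j) (+ suc t * + (t C j)) ⟩
      (+ j * + (suc t C j) + + suc t * + (t C j)) * (s j * f j) + (+ suc t * + (t C j)) * (- s j * f j)
        ≡⟨ cong (λ z → z * (s j * f j) + (+ suc t * + (t C j)) * (- s j * f j)) (absorb j) ⟩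
      (+ suc t * + (suc t C j)) * (s j * f j) + (+ suc t * + (t C j)) * (- s j * f j)
        ≡⟨ rearrange₂ (+ suc t) (+ (suc t C j)) (+ (t C j)) (s j) (f j) ⟩
      + suc t * (+ (suc t C j) * (s j * f j)) + + suc t * (+ (t C j) * (- s j * f j)) ∎
    -- Minus the sign for `suc t` is the sign for `t`, and the surplus index `suc t` has binomial
    -- coefficient 0.
    lower : ∑< (2 ℕ.+ t) (λ j → + (t C j) * (- s j * f j)) ≡ Δ t f
    lower = begin
      ∑< (2 ℕ.+ t) (λ j → + (t C j) * (- s j * f j))
        ≡⟨ ∑<-last (suc t) (λ j → + (t C j) * (- s j * f j)) ⟩
      ∑< (suc t) (λ j → + (t C j) * (- s j * f j)) + + (t C suc t) * (- s (suc t) * f (suc t))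
        ≡⟨ cong₂ _+_ (∑<-cong (suc t) (λ j j≤t → cong (λ z → + (t C j) * (z * f j))
                        (trans (cong -_ (sign-suc-∸ j≤t)) (ℤ.neg-involutive (sign (t ∸ j))))))
                     (cong (λ c → + c * (- s (suc t) * f (suc t))) (k>n⇒nCk≡0 (ℕ.n<1+n t))) ⟩
      Δ t f + 0ℤ * (- s (suc t) * f (suc t))
        ≡⟨ ℤ.+-identityʳ (Δ t f) ⟩
      Δ t f ∎

  -- Inclusion-exclusion for surjections, obtained by checking that both sides obey the same
  -- recursion in h.
  Δ-^ : ∀ h t → Δ t (λ j → + (j ℕ.^ h)) ≡ + surj h t
  Δ-^ zero    zero    = refl
  Δ-^ zero    (suc t) = trans (Δ-suc t (λ _ → 1ℤ)) (Δ-zero t)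
  Δ-^ (suc h) zero    = refl
  Δ-^ (suc h) (suc t) = begin
    Δ (suc t) (λ j → + (j ℕ.* j ℕ.^ h))                             ≡⟨ Δ-cong (suc t) (λ j → ℤ.pos-* j (j ℕ.^ h)) ⟩
    Δ (suc t) (λ j → + j * + (j ℕ.^ h))                             ≡⟨ Δ-* t (λ j → + (j ℕ.^ h)) ⟩
    + suc t * (Δ (suc t) (λ j → + (j ℕ.^ h)) + Δ t (λ j → + (j ℕ.^ h)))
      ≡⟨ cong (+ suc t *_) (cong₂ _+_ (Δ-^ h (suc t)) (Δ-^ h t)) ⟩
    + suc t * + (surj h (suc t) ℕ.+ surj h t)                       ≡⟨ ℤ.pos-* (suc t) (surj h (suc t) ℕ.+ surj h t) ⟨
    + (suc t ℕ.* (surj h (suc t) ℕ.+ surj h t))                     ∎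

  t!*S≡surj : ∀ h t → + (t !) * S h t ≡ + surj h t
  t!*S≡surj h t = begin
    + (t !) * S h t                     ≡⟨ cong (λ n → + (t !) * (n ℤ./ℕ t !)) numerator ⟩
    + (t !) * + (surj h t ℕ./ t !)      ≡⟨ ℤ.pos-* (t !) (surj h t ℕ./ t !) ⟨
    + (t ! ℕ.* (surj h t ℕ./ t !))      ≡⟨ cong +_ (ℕ.*-comm (t !) (surj h t ℕ./ t !)) ⟩
    + (surj h t ℕ./ t ! ℕ.* t !)        ≡⟨ cong +_ (m/n*n≡m (t!∣surj h t)) ⟩
    + surj h t                          ∎
    where
    instance _ = t ℕ.!≢0
    rearrange : ∀ s c f → s * c * f ≡ c * (s * f)
    rearrange = ℤSolver.solve-∀
    numerator : ∑ (range 0 t) (λ j → sign (t ∸ j) * + (t C j) * + (j ℕ.^ h)) ≡ + surj h t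
    numerator = begin
      ∑ (range 0 t) (λ j → sign (t ∸ j) * + (t C j) * + (j ℕ.^ h))
        ≡⟨ ∑-range 0 t (λ j → sign (t ∸ j) * + (t C j) * + (j ℕ.^ h)) ⟩
      ∑< (suc t) (λ j → sign (t ∸ j) * + (t C j) * + (j ℕ.^ h))
        ≡⟨ ∑-cong (upTo (suc t)) (λ j → rearrange (sign (t ∸ j)) (+ (t C j)) (+ (j ℕ.^ h))) ⟩
      Δ t (λ j → + (j ℕ.^ h))
        ≡⟨ Δ-^ h t ⟩
      + surj h t ∎

  -- shiftC n j t is the coefficient of y^t in y^j (1 + y)^n.
  shiftC : ℕ → ℕ → ℕ → ℕ
  shiftC n zero    t       = n C t
  shiftC n (suc j) zero    = 0
  shiftC n (suc j) (suc t) = shiftC n j t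

  shiftC-0 : ∀ n j → shiftC (suc n) j 0 ≡ shiftC n j 0
  shiftC-0 n zero    = refl
  shiftC-0 n (suc j) = refl

  shiftC-suc : ∀ n j t → shiftC (suc n) j (suc t) ≡ shiftC n j t ℕ.+ shiftC n j (suc t)
  shiftC-suc n zero    t       = sym (nCk+nC[k+1]≡[n+1]C[k+1] n t)
  shiftC-suc n (suc j) zero    = shiftC-0 n j
  shiftC-suc n (suc j) (suc t) = shiftC-suc n j t

  t<j⇒shiftC≡0 : ∀ n j t → t < j → shiftC n j t ≡ 0
  t<j⇒shiftC≡0 n (suc j) zero    _         = refl
  t<j⇒shiftC≡0 n (suc j) (suc t) (s≤s t<j) = t<j⇒shiftC≡0 n j t t<j

  shiftC-+ : ∀ n j s → shiftC n j (j ℕ.+ s) ≡ n C s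
  shiftC-+ n zero    s = refl
  shiftC-+ n (suc j) s = shiftC-+ n j s

  -- For t = j + s ≤ N this is the symmetry of binomial coefficients, as N - t = (N - j) - s. For t
  -- > N the lower index on the right is negative, where `binomℤ` is 0, and on the left s exceeds N
  -- - j.
  C-binomℤ : ∀ N j s → j ≤ N → (N ∸ j) C s ≡ binomℤ (N ∸ j) (+ N - + (j ℕ.+ s))
  C-binomℤ N j s j≤N with j ℕ.+ s ℕ.≤? N
  ... | yes t≤N = begin
    (N ∸ j) C s                                   ≡⟨ nCk≡nC[n∸k] (subst (_≤ N ∸ j) (ℕ.m+n∸m≡n j s) (ℕ.∸-monoˡ-≤ j t≤N)) ⟩
    (N ∸ j) C (N ∸ j ∸ s)                         ≡⟨ cong ((N ∸ j) C_) (ℕ.∸-+-assoc N j s) ⟩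
    binomℤ (N ∸ j) (+ (N ∸ (j ℕ.+ s)))            ≡⟨ cong (binomℤ (N ∸ j)) (trans (ℤ.m-n≡m⊖n N (j ℕ.+ s)) (ℤ.⊖-≥ t≤N)) ⟨
    binomℤ (N ∸ j) (+ N - + (j ℕ.+ s))            ∎
  ... | no t≰N = begin
    (N ∸ j) C s                                     ≡⟨ k>n⇒nCk≡0 (ℕ.+-cancelˡ-< j (N ∸ j) s (subst (_< j ℕ.+ s) (sym (ℕ.m+[n∸m]≡n j≤N)) N<t)) ⟩
    0                                               ≡⟨ negative (j ℕ.+ s ∸ N) (ℕ.m<n⇒0<n∸m N<t) ⟨
    binomℤ (N ∸ j) (- + (j ℕ.+ s ∸ N))              ≡⟨ cong (binomℤ (N ∸ j)) (trans (ℤ.m-n≡m⊖n N (j ℕ.+ s)) (ℤ.⊖-< N<t)) ⟨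
    binomℤ (N ∸ j) (+ N - + (j ℕ.+ s))              ∎
    where
    N<t = ℕ.≰⇒> t≰N
    negative : ∀ k → 0 < k → binomℤ (N ∸ j) (- + k) ≡ 0
    negative (suc k) _ = refl

  sign-+ : ∀ m n → sign (m ℕ.+ n) ≡ sign m * sign n
  sign-+ = ℤ.^-distribˡ-+-* -1ℤ

  sign-square : ∀ n → sign n * sign n ≡ 1ℤ
  sign-square zero    = refl
  sign-square (suc n) = trans (rearrange (sign n)) (sign-square n)
    where
    rearrange : ∀ s → (-1ℤ * s) * (-1ℤ * s) ≡ s * s
    rearrange = ℤSolver.solve-∀

  neg-^ : ∀ x n → (- x) ^ n ≡ sign n * x ^ n
  neg-^ x zero    = refl
  neg-^ x (suc n) = trans (cong (- x *_) (neg-^ x n)) (rearrange x (sign n) (x ^ n))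
    where
    rearrange : ∀ x s p → - x * (s * p) ≡ (-1ℤ * s) * (x * p)
    rearrange = ℤSolver.solve-∀

  *-^ : ∀ a b n → (a ℕ.* b) ℕ.^ n ≡ a ℕ.^ n ℕ.* b ℕ.^ n
  *-^ a b zero    = refl
  *-^ a b (suc n) = trans (cong (a ℕ.* b ℕ.*_) (*-^ a b n)) (rearrange a b (a ℕ.^ n) (b ℕ.^ n))
    where
    rearrange : ∀ a b x y → a ℕ.* b ℕ.* (x ℕ.* y) ≡ a ℕ.* x ℕ.* (b ℕ.* y)
    rearrange = ℕSolver.solve-∀

  i≡-i⇒i≡0 : ∀ i → i ≡ - i → i ≡ 0ℤ
  i≡-i⇒i≡0 (+ zero)  _  = refl
  i≡-i⇒i≡0 (+ suc n) ()
  i≡-i⇒i≡0 -[1+ n ]  ()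

-- The field with 2^r elements: permutations of F, Frobenius, roots of polynomials, trace.

module BinaryField (r′ : ℕ) (K : GF2^ (suc r′)) where
  open GF2^ K
  open FF K
  open IsCommutativeRing isCommutativeRing
    using (+-assoc; +-comm; +-identityˡ; +-identityʳ; *-assoc; *-identityˡ; *-identityʳ; distribʳ; zeroˡ; zeroʳ
          ; isCommutativeSemiring; *-isCommutativeMonoid)
  private
    R : CommutativeRing 0ℓ 0ℓ
    R = record { isCommutativeRing = isCommutativeRing }
    r = suc r′
  open NatSolver (CommutativeRing.commutativeSemiring R) using (solve; _:=_; _:+_; _:*_; con)
  module ∑F = Sum isCommutativeSemiring
  open ∑ℤ

  x*y≡0⇒y≡0 : ∀ {x y} → x ≢ 0# → x * y ≡ 0# → y ≡ 0#
  x*y≡0⇒y≡0 {x} {y} x≢0 xy≡0 = begin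
    y                   ≡⟨ *-identityˡ y ⟨
    1# * y              ≡⟨ cong (_* y) (⁻¹-inverse x x≢0) ⟨
    x * (x ⁻¹) * y      ≡⟨ solve 3 (λ x i y → x :* i :* y := i :* (x :* y)) refl x (x ⁻¹) y ⟩
    (x ⁻¹) * (x * y)    ≡⟨ cong ((x ⁻¹) *_) xy≡0 ⟩
    (x ⁻¹) * 0#         ≡⟨ zeroʳ (x ⁻¹) ⟩
    0#                  ∎

  *-cancelˡ : ∀ {x y z} → x ≢ 0# → x * y ≡ x * z → y ≡ z
  *-cancelˡ {x} {y} {z} x≢0 eq = begin
    y                 ≡⟨ unit y ⟨
    (x ⁻¹) * (x * y)  ≡⟨ cong ((x ⁻¹) *_) eq ⟩
    (x ⁻¹) * (x * z)  ≡⟨ unit z ⟩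
    z                 ∎
    where
    unit : ∀ y → (x ⁻¹) * (x * y) ≡ y
    unit y = begin
      (x ⁻¹) * (x * y)  ≡⟨ solve 3 (λ x i y → i :* (x :* y) := x :* i :* y) refl x (x ⁻¹) y ⟩
      x * (x ⁻¹) * y    ≡⟨ cong (_* y) (⁻¹-inverse x x≢0) ⟩
      1# * y            ≡⟨ *-identityˡ y ⟩
      y                 ∎

  *-nonzero : ∀ {x y} → x ≢ 0# → y ≢ 0# → x * y ≢ 0#
  *-nonzero x≢0 y≢0 = y≢0 ∘ x*y≡0⇒y≡0 x≢0

  ∈-elems : ∀ x → x ∈ elems
  ∈-elems x = subst (_∈ elems) (Inverse.inverseˡ enum refl) (∈-map⁺ (Inverse.to enum) (∈-allFin (Inverse.from enum x)))

  elems-unique : Unique elems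
  elems-unique = Unique.map⁺ (λ {i} {j} eq → trans (sym (from∘to i)) (trans (cong (Inverse.from enum) eq) (from∘to j)))
    (Unique.allFin⁺ q)
    where
    from∘to : ∀ i → Inverse.from enum (Inverse.to enum i) ≡ i
    from∘to i = Inverse.inverseʳ enum refl

  length-elems : length elems ≡ q
  length-elems = trans (length-map (Inverse.to enum) (allFin q)) (length-tabulate id)

  private
    nonzeros : List F → List F
    nonzeros = foldr (λ x xs → if isZero x then xs else x ∷ xs) []

    ∈-nonzeros⁺ : ∀ {x} xs → x ≢ 0# → x ∈ xs → x ∈ nonzeros xs
    ∈-nonzeros⁺ (y ∷ ys) x≢0 x∈ with y ≟ 0# | x∈
    ... | yes y≡0 | here x≡y  = contradiction (trans x≡y y≡0) x≢0
    ... | yes _   | there x∈′ = ∈-nonzeros⁺ ys x≢0 x∈′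
    ... | no _    | here x≡y  = here x≡y
    ... | no _    | there x∈′ = there (∈-nonzeros⁺ ys x≢0 x∈′)

    ∈-nonzeros⁻ : ∀ {x} xs → x ∈ nonzeros xs → x ≢ 0# × x ∈ xs
    ∈-nonzeros⁻ (y ∷ ys) x∈ with y ≟ 0# | x∈
    ... | yes _  | x∈′       = let p , q = ∈-nonzeros⁻ ys x∈′ in p , there q
    ... | no y≢0 | here refl = y≢0 , here refl
    ... | no _   | there x∈′ = let p , q = ∈-nonzeros⁻ ys x∈′ in p , there q

    nonzeros-unique : ∀ {xs} → Unique xs → Unique (nonzeros xs)
    nonzeros-unique {[]}     []        = []
    nonzeros-unique {y ∷ ys} (y∉ ∷ u) with y ≟ 0#
    ... | yes _ = nonzeros-unique u
    ... | no _  = All.tabulate (λ x∈ → All.lookup y∉ (proj₂ (∈-nonzeros⁻ ys x∈))) ∷ nonzeros-unique u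

  ∈-elems* : ∀ {x} → x ≢ 0# → x ∈ elems*
  ∈-elems* {x} x≢0 = ∈-nonzeros⁺ elems x≢0 (∈-elems x)

  ∈-elems*⇒≢0 : ∀ {x} → x ∈ elems* → x ≢ 0#
  ∈-elems*⇒≢0 = proj₁ ∘ ∈-nonzeros⁻ elems

  elems*-unique : Unique elems*
  elems*-unique = nonzeros-unique elems-unique

  -- Splits a sum over all a in F into the term of the trivial character, a = 0, and a sum over the
  -- units.
  elems↭0∷elems* : elems ↭ 0# ∷ elems*
  elems↭0∷elems* = unique∧⊆∧⊇⇒↭ elems-unique
    (All.tabulate (λ x∈ 0≡x → ∈-elems*⇒≢0 x∈ (sym 0≡x)) ∷ elems*-unique)
    (λ {x} _ → split x) (λ {x} _ → ∈-elems x)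
    where
    split : ∀ x → x ∈ 0# ∷ elems*
    split x with x ≟ 0#
    ... | yes x≡0 = here x≡0
    ... | no  x≢0 = there (∈-elems* x≢0)

  length-elems* : suc (length elems*) ≡ q
  length-elems* = trans (sym (↭-length elems↭0∷elems*)) length-elems

  module _ (f g : F → F) (f∘g : ∀ x → f (g x) ≡ x) (g∘f : ∀ x → g (f x) ≡ x) where
    private
      f-injective : ∀ {x y} → f x ≡ f y → x ≡ y
      f-injective {x} {y} eq = trans (sym (g∘f x)) (trans (cong g eq) (g∘f y))

    -- Every substitution in a sum over F rests on this: the inverse `g` gives both injectivity,
    -- hence no repetitions in the image, and a preimage of each element.
    map-elems-↭ : map f elems ↭ elems
    map-elems-↭ = unique∧⊆∧⊇⇒↭ (Unique.map⁺ f-injective elems-unique) elems-unique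
      (λ {x} _ → ∈-elems x)
      (λ {x} _ → subst (_∈ map f elems) (f∘g x) (∈-map⁺ f (∈-elems (g x))))

    map-elems*-↭ : f 0# ≡ 0# → map f elems* ↭ elems*
    map-elems*-↭ f0≡0 = unique∧⊆∧⊇⇒↭ (Unique.map⁺ f-injective elems*-unique) elems*-unique ⊆ ⊇
      where
      ⊆ : ∀ {x} → x ∈ map f elems* → x ∈ elems*
      ⊆ x∈ with find∈ x∈
        where
        find∈ : ∀ {x} → x ∈ map f elems* → ∃ λ y → y ∈ elems* × x ≡ f y
        find∈ = ∈-map⁻ f
      ... | y , y∈ , refl = ∈-elems* (λ fy≡0 → ∈-elems*⇒≢0 y∈ (f-injective (trans fy≡0 (sym f0≡0))))
      ⊇ : ∀ {x} → x ∈ elems* → x ∈ map f elems*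
      ⊇ {x} x∈ = subst (_∈ map f elems*) (f∘g x) (∈-map⁺ f (∈-elems* gx≢0))
        where
        gx≢0 : g x ≢ 0#
        gx≢0 gx≡0 = ∈-elems*⇒≢0 x∈ (trans (sym (f∘g x)) (trans (cong f gx≡0) f0≡0))

    ∑-elems-↭ : (φ : F → ℤ) → ∑ elems (φ ∘ f) ≡ ∑ elems φ
    ∑-elems-↭ φ = trans (sym (∑-map elems f φ)) (∑-↭ φ map-elems-↭)

    ∑-elems*-↭ : f 0# ≡ 0# → (φ : F → ℤ) → ∑ elems* (φ ∘ f) ≡ ∑ elems* φ
    ∑-elems*-↭ f0≡0 φ = trans (sym (∑-map elems* f φ)) (∑-↭ φ (map-elems*-↭ f0≡0))

  ∑-elems : (φ : F → ℤ) → ∑ elems φ ≡ φ 0# ℤ.+ ∑ elems* φ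
  ∑-elems φ = ∑-↭ φ elems↭0∷elems*

  pow-+ : ∀ x m n → pow x (m ℕ.+ n) ≡ pow x m * pow x n
  pow-+ x zero    n = sym (*-identityˡ (pow x n))
  pow-+ x (suc m) n = trans (cong (x *_) (pow-+ x m n)) (sym (*-assoc x (pow x m) (pow x n)))

  pow-distrib-* : ∀ x y n → pow (x * y) n ≡ pow x n * pow y n
  pow-distrib-* x y zero    = sym (*-identityˡ 1#)
  pow-distrib-* x y (suc n) = trans (cong (x * y *_) (pow-distrib-* x y n))
    (solve 4 (λ x y a b → x :* y :* (a :* b) := x :* a :* (y :* b)) refl x y (pow x n) (pow y n))

  pow-nonzero : ∀ {x} n → x ≢ 0# → pow x n ≢ 0#
  pow-nonzero zero    x≢0 = 0≢1 ∘ sym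
  pow-nonzero (suc n) x≢0 = *-nonzero x≢0 (pow-nonzero n x≢0)

  pow-2^suc : ∀ x i → pow x (2 ℕ.^ suc i) ≡ pow (x * x) (2 ℕ.^ i)
  pow-2^suc x i = begin
    pow x (n ℕ.+ (n ℕ.+ 0))  ≡⟨ cong (λ k → pow x (n ℕ.+ k)) (ℕ.+-identityʳ n) ⟩
    pow x (n ℕ.+ n)          ≡⟨ pow-+ x n n ⟩
    pow x n * pow x n        ≡⟨ pow-distrib-* x x n ⟨
    pow (x * x) n            ∎
    where n = 2 ℕ.^ i

  -- Translation by 1 permutes F, so Σ x = Σ (1 + x) and hence q·1 = 0.
  1+1≡0 : 1# + 1# ≡ 0#
  1+1≡0 with (1# + 1#) ≟ 0#
  ... | yes p = p
  -- By repeated doubling, q · 1 equals (1 + 1)^r, which would be nonzero if 1 + 1 were.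
  ... | no ¬p = contradiction (trans (sym (2^·1 r)) q·1≡0) (pow-nonzero r ¬p)
    where
    ·-+ : ∀ m n x → (m ℕ.+ n) · x ≡ (m · x) + (n · x)
    ·-+ zero    n x = sym (+-identityˡ (n · x))
    ·-+ (suc m) n x = trans (cong (x +_) (·-+ m n x)) (sym (+-assoc x (m · x) (n · x)))
    2^·1 : ∀ i → (2 ℕ.^ i) · 1# ≡ pow (1# + 1#) i
    2^·1 zero    = +-identityʳ 1#
    2^·1 (suc i) = begin
      (n ℕ.+ (n ℕ.+ 0)) · 1#              ≡⟨ cong (λ k → (n ℕ.+ k) · 1#) (ℕ.+-identityʳ n) ⟩
      (n ℕ.+ n) · 1#                      ≡⟨ ·-+ n n 1# ⟩
      (n · 1#) + (n · 1#)                 ≡⟨ cong (λ x → x + x) (2^·1 i) ⟩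
      pow (1# + 1#) i + pow (1# + 1#) i   ≡⟨ solve 1 (λ x → x :+ x := (con 1 :+ con 1) :* x) refl (pow (1# + 1#) i) ⟩
      (1# + 1#) * pow (1# + 1#) i         ∎
      where n = 2 ℕ.^ i
    ∑1 : ∀ {X : Set} (xs : List X) → ∑F.∑ xs (λ _ → 1#) ≡ length xs · 1#
    ∑1 []       = refl
    ∑1 (x ∷ xs) = cong (1# +_) (∑1 xs)
    -1# = - 1#
    -1+1 : -1# + 1# ≡ 0#
    -1+1 = IsCommutativeRing.-‿inverseˡ isCommutativeRing 1#
    shift : map (1# +_) elems ↭ elems
    shift = map-elems-↭ (1# +_) (-1# +_)
      (λ x → trans (solve 3 (λ a b x → a :+ (b :+ x) := b :+ a :+ x) refl 1# -1# x) (trans (cong (_+ x) -1+1) (+-identityˡ x)))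
      (λ x → trans (sym (+-assoc -1# 1# x)) (trans (cong (_+ x) -1+1) (+-identityˡ x)))
    q·1≡0 : q · 1# ≡ 0#
    q·1≡0 = begin
      q · 1#                                              ≡⟨ cong (_· 1#) length-elems ⟨
      length elems · 1#                                   ≡⟨ ∑1 elems ⟨
      ∑F.∑ elems (λ _ → 1#)                               ≡⟨ +-identityʳ _ ⟨
      ∑F.∑ elems (λ _ → 1#) + 0#                          ≡⟨ cong (∑F.∑ elems (λ _ → 1#) +_) (IsCommutativeRing.-‿inverseʳ isCommutativeRing s) ⟨
      ∑F.∑ elems (λ _ → 1#) + (s + - s)                   ≡⟨ +-assoc _ s (- s) ⟨
      ∑F.∑ elems (λ _ → 1#) + s + - s                     ≡⟨ cong (_+ - s) (∑F.∑-+ elems (λ _ → 1#) id) ⟨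
      ∑F.∑ elems (1# +_) + - s                            ≡⟨ cong (_+ - s) (trans (sym (∑F.∑-map elems (1# +_) id)) (∑F.∑-↭ id shift)) ⟩
      s + - s                                             ≡⟨ IsCommutativeRing.-‿inverseʳ isCommutativeRing s ⟩
      0#                                                  ∎
      where s = ∑F.∑ elems id

  x+x≡0 : ∀ x → x + x ≡ 0#
  x+x≡0 x = begin
    x + x              ≡⟨ solve 1 (λ x → x :+ x := (con 1 :+ con 1) :* x) refl x ⟩
    (1# + 1#) * x      ≡⟨ cong (_* x) 1+1≡0 ⟩
    0# * x             ≡⟨ zeroˡ x ⟩
    0#                 ∎

  x+y+y≡x : ∀ x y → x + y + y ≡ x
  x+y+y≡x x y = trans (+-assoc x y y) (trans (cong (x +_) (x+x≡0 y)) (+-identityʳ x))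

  x+y≡0⇒x≡y : ∀ {x y} → x + y ≡ 0# → x ≡ y
  x+y≡0⇒x≡y {x} {y} eq = trans (sym (x+y+y≡x x y)) (trans (cong (_+ y) eq) (+-identityˡ y))

  sq-+ : ∀ x y → (x + y) * (x + y) ≡ x * x + y * y
  sq-+ x y = begin
    (x + y) * (x + y)                 ≡⟨ solve 2 (λ x y → (x :+ y) :* (x :+ y) := x :* x :+ y :* y :+ (x :* y :+ x :* y)) refl x y ⟩
    x * x + y * y + (x * y + x * y)   ≡⟨ cong (x * x + y * y +_) (x+x≡0 (x * y)) ⟩
    x * x + y * y + 0#                ≡⟨ +-identityʳ _ ⟩
    x * x + y * y                     ∎

  pow-2^-+ : ∀ i x y → pow (x + y) (2 ℕ.^ i) ≡ pow x (2 ℕ.^ i) + pow y (2 ℕ.^ i)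
  pow-2^-+ zero    x y = distribʳ 1# x y
  pow-2^-+ (suc i) x y = begin
    pow (x + y) (2 ℕ.^ suc i)                           ≡⟨ pow-2^suc (x + y) i ⟩
    pow ((x + y) * (x + y)) (2 ℕ.^ i)                   ≡⟨ cong (λ z → pow z (2 ℕ.^ i)) (sq-+ x y) ⟩
    pow (x * x + y * y) (2 ℕ.^ i)                       ≡⟨ pow-2^-+ i (x * x) (y * y) ⟩
    pow (x * x) (2 ℕ.^ i) + pow (y * y) (2 ℕ.^ i)       ≡⟨ cong₂ _+_ (pow-2^suc x i) (pow-2^suc y i) ⟨
    pow x (2 ℕ.^ suc i) + pow y (2 ℕ.^ suc i)           ∎

  -- Fermat's argument: multiplication by x ≠ 0 permutes the units and multiplies their product by
  -- x^(q-1), and that product can be cancelled.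
  pow-q : ∀ x → pow x q ≡ x
  pow-q x with x ≟ 0#
  ... | yes refl = trans (cong (pow 0#) (sym length-elems*)) (zeroˡ _)
  ... | no x≢0 = begin
    pow x q                        ≡⟨ cong (pow x) length-elems* ⟨
    x * pow x (length elems*)      ≡⟨ cong (x *_) (*-cancelˡ (∏-nonzero elems* (All.tabulate ∈-elems*⇒≢0)) fermat) ⟩
    x * 1#                         ≡⟨ *-identityʳ x ⟩
    x                              ∎
    where
    ∏ : List F → F
    ∏ = foldr _*_ 1#
    ∏-map : ∀ xs → ∏ (map (x *_) xs) ≡ ∏ xs * pow x (length xs)
    ∏-map []       = sym (*-identityˡ 1#)
    ∏-map (y ∷ ys) = trans (cong (x * y *_) (∏-map ys))
      (solve 4 (λ x y p n → x :* y :* (p :* n) := y :* p :* (x :* n)) refl x y (∏ ys) (pow x (length ys)))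
    ∏-nonzero : ∀ xs → All (_≢ 0#) xs → ∏ xs ≢ 0#
    ∏-nonzero []       []          = 0≢1 ∘ sym
    ∏-nonzero (y ∷ ys) (y≢0 ∷ ys≢0) = *-nonzero y≢0 (∏-nonzero ys ys≢0)
    scale : map (x *_) elems* ↭ elems*
    scale = map-elems*-↭ (x *_) ((x ⁻¹) *_)
      (λ y → trans (sym (*-assoc x (x ⁻¹) y)) (trans (cong (_* y) (⁻¹-inverse x x≢0)) (*-identityˡ y)))
      (λ y → *-cancelˡ x≢0 (trans (sym (*-assoc x (x ⁻¹) _)) (trans (cong (_* (x * y)) (⁻¹-inverse x x≢0)) (*-identityˡ _))))
      (zeroʳ x)
    fermat : ∏ elems* * pow x (length elems*) ≡ ∏ elems* * 1#
    fermat = begin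
      ∏ elems* * pow x (length elems*)   ≡⟨ ∏-map elems* ⟨
      ∏ (map (x *_) elems*)              ≡⟨ foldr-commMonoid (setoid F) *-isCommutativeMonoid (↭⇒↭ₛ scale) ⟩
      ∏ elems*                           ≡⟨ *-identityʳ _ ⟨
      ∏ elems* * 1#                      ∎

  -- The (r-1)-st iterate of Frobenius. One more squaring gives x^q = x, so it inverts squaring on
  -- both sides.
  sqrt : F → F
  sqrt x = pow x (2 ℕ.^ r′)

  sqrt-sq : ∀ x → sqrt (x * x) ≡ x
  sqrt-sq x = trans (sym (pow-2^suc x r′)) (pow-q x)

  sq-sqrt : ∀ x → sqrt x * sqrt x ≡ x
  sq-sqrt x = trans (sym (pow-distrib-* x x (2 ℕ.^ r′))) (sqrt-sq x)

  -- The monic polynomial with the given lower coefficients, constant term first.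
  monic : List F → F → F
  monic []       x = 1#
  monic (c ∷ cs) x = c + x * monic cs x

  -- The number of lower coefficients is the degree. Dividing by Y + x, which is Y - x in
  -- characteristic 2, lowers it by one and keeps the other roots, since a product with a nonzero
  -- factor vanishes only if the other factor does.
  monic-roots : ∀ cs xs → Unique xs → All (λ x → monic cs x ≡ 0#) xs → length xs ≤ length cs
  monic-roots cs       []       _        _           = z≤n
  monic-roots []       (x ∷ xs) _        (1≡0 ∷ _)   = contradiction (sym 1≡0) 0≢1
  monic-roots (a ∷ cs) (x ∷ xs) (x∉ ∷ u) (fx≡0 ∷ fs) =
    s≤s (subst (length xs ≤_) (length-quotient a cs) (monic-roots (quotient cs) xs u (All.tabulate root)))
    where
    -- Synthetic division: the coefficients of the quotient are the Horner values at x of the tails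
    -- of the coefficient list.
    quotient : List F → List F
    quotient []       = []
    quotient (b ∷ bs) = monic (b ∷ bs) x ∷ quotient bs
    length-quotient : ∀ a cs → length (quotient cs) ≡ length cs
    length-quotient a []       = refl
    length-quotient a (b ∷ bs) = cong suc (length-quotient b bs)
    division : ∀ a cs y → monic (a ∷ cs) y ≡ (y + x) * monic (quotient cs) y + monic (a ∷ cs) x
    division a []       y = begin
      a + y * 1#                        ≡⟨ x+y+y≡x _ (x * 1#) ⟨
      a + y * 1# + x * 1# + x * 1#      ≡⟨ solve 4 (λ a y x i → a :+ y :* i :+ x :* i :+ x :* i := (y :+ x) :* i :+ (a :+ x :* i)) refl a y x 1# ⟩
      (y + x) * 1# + (a + x * 1#)       ∎
    division a (b ∷ bs) y = begin
      a + y * monic (b ∷ bs) y          ≡⟨ cong (λ z → a + y * z) (division b bs y) ⟩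
      a + y * ((y + x) * Q + E)         ≡⟨ x+y+y≡x _ (x * E) ⟨
      a + y * ((y + x) * Q + E) + x * E + x * E
        ≡⟨ solve 5 (λ a y x Q E → a :+ y :* ((y :+ x) :* Q :+ E) :+ x :* E :+ x :* E
                                  := (y :+ x) :* (E :+ y :* Q) :+ (a :+ x :* E)) refl a y x Q E ⟩
      (y + x) * (E + y * Q) + (a + x * E) ∎
      where
      Q = monic (quotient bs) y
      E = monic (b ∷ bs) x
    root : ∀ {y} → y ∈ xs → monic (quotient cs) y ≡ 0#
    root {y} y∈ = x*y≡0⇒y≡0 (λ y+x≡0 → All.lookup x∉ y∈ (sym (x+y≡0⇒x≡y y+x≡0))) (begin
      (y + x) * monic (quotient cs) y                       ≡⟨ +-identityʳ _ ⟨
      (y + x) * monic (quotient cs) y + 0#                  ≡⟨ cong ((y + x) * monic (quotient cs) y +_) fx≡0 ⟨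
      (y + x) * monic (quotient cs) y + monic (a ∷ cs) x    ≡⟨ division a cs y ⟨
      monic (a ∷ cs) y                                      ≡⟨ All.lookup fs y∈ ⟩
      0#                                                    ∎)

  tr-+ : ∀ x y → tr (x + y) ≡ tr x + tr y
  tr-+ x y = trans (∑F.∑-cong (upTo r) (λ i → pow-2^-+ i x y))
    (∑F.∑-+ (upTo r) (λ i → pow x (2 ℕ.^ i)) (λ i → pow y (2 ℕ.^ i)))

  -- Squaring shifts the exponents 2^i by one; the new term x^q equals the term x that is lost.
  tr-sq : ∀ x → tr (x * x) ≡ tr x
  tr-sq x = begin
    tr (x * x)                              ≡⟨ ∑F.∑-cong (upTo r) (λ i → sym (pow-2^suc x i)) ⟩
    t                                       ≡⟨ x+y+y≡x t x ⟨
    t + x + x                               ≡⟨ cong (_+ x) (+-comm t x) ⟩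
    x + t + x                               ≡⟨ cong (λ z → z + t + x) (*-identityʳ x) ⟨
    p 0 + t + x                             ≡⟨ cong (_+ x) (∑F.∑<-suc r p) ⟨
    ∑F.∑< (suc r) p + x                     ≡⟨ cong (_+ x) (∑F.∑<-last r p) ⟩
    tr x + pow x q + x                      ≡⟨ cong (λ z → tr x + z + x) (pow-q x) ⟩
    tr x + x + x                            ≡⟨ x+y+y≡x (tr x) x ⟩
    tr x                                    ∎
    where
    p : ℕ → F
    p i = pow x (2 ℕ.^ i)
    t = ∑F.∑< r (p ∘ suc)

  sq-tr : ∀ x → tr x * tr x ≡ tr (x * x)
  sq-tr x = go (upTo r)
    where
    go : ∀ is → ∑F.∑ is (λ i → pow x (2 ℕ.^ i)) * ∑F.∑ is (λ i → pow x (2 ℕ.^ i)) ≡ ∑F.∑ is (λ i → pow (x * x) (2 ℕ.^ i))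
    go []       = zeroˡ 0#
    go (i ∷ is) = trans (sq-+ _ _) (cong₂ _+_ (sym (pow-distrib-* x x (2 ℕ.^ i))) (go is))

  tr≡0∨1 : ∀ x → tr x ≡ 0# ⊎ tr x ≡ 1#
  tr≡0∨1 x with tr x ≟ 0#
  ... | yes p = inj₁ p
  ... | no ¬p = inj₂ (*-cancelˡ ¬p (trans (sq-tr x) (trans (tr-sq x) (sym (*-identityʳ (tr x))))))

  tr-0 : tr 0# ≡ 0#
  tr-0 = trans (cong tr (sym (+-identityˡ 0#))) (trans (tr-+ 0# 0#) (x+x≡0 (tr 0#)))

  -- tr is a monic polynomial function of degree 2^(r-1) < q, so it has a non-root.
  tr-nonzero : ∃ λ b → tr b ≢ 0#
  tr-nonzero with all? (λ x → tr x ≟ 0#) elems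
  ... | no ¬all = let b , _ , tr≢0 = find (¬All⇒Any¬ (λ x → tr x ≟ 0#) elems ¬all) in b , tr≢0
  ... | yes all = contradiction
      (subst (ℕ._≤ 2 ℕ.^ r′) length-elems
        (subst (length elems ≤_) (length-coeffs r′)
          (monic-roots (0# ∷ coeffs r′) elems elems-unique (All.map (λ {x} → trans (monic-coeffs r′ x)) all))))
      (ℕ.<⇒≱ (ℕ.^-monoʳ-< 2 (s≤s (s≤s z≤n)) (ℕ.n<1+n r′)))
    where
    expand : List F → List F
    expand []       = []
    expand (c ∷ cs) = c ∷ 0# ∷ expand cs
    -- The lower coefficients of Σ x^(2^i - 1) for i ≤ n, the trace-like sum divided by x. The
    -- recursion comes from Σ x^(2^i) for i ≤ n + 1 being x plus the sum for n taken at x²; `expand`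
    -- performs the substitution of x².
    coeffs : ℕ → List F
    coeffs zero    = []
    coeffs (suc n) = 1# ∷ expand (coeffs n)
    length-expand : ∀ cs → length (expand cs) ≡ 2 ℕ.* length cs
    length-expand []       = refl
    length-expand (c ∷ cs) = trans (cong (2 ℕ.+_) (length-expand cs)) (sym (ℕ.*-suc 2 (length cs)))
    length-coeffs : ∀ n → suc (length (coeffs n)) ≡ 2 ℕ.^ n
    length-coeffs zero    = refl
    length-coeffs (suc n) = trans (cong (2 ℕ.+_) (length-expand (coeffs n)))
      (trans (sym (ℕ.*-suc 2 (length (coeffs n)))) (cong (2 ℕ.*_) (length-coeffs n)))
    monic-expand : ∀ cs x → monic (expand cs) x ≡ monic cs (x * x)
    monic-expand []       x = refl
    monic-expand (c ∷ cs) x = cong (c +_) (begin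
      x * (0# + x * monic (expand cs) x)  ≡⟨ cong (x *_) (+-identityˡ _) ⟩
      x * (x * monic (expand cs) x)       ≡⟨ *-assoc x x _ ⟨
      x * x * monic (expand cs) x         ≡⟨ cong (x * x *_) (monic-expand cs x) ⟩
      x * x * monic cs (x * x)            ∎)
    monic-coeffs : ∀ n x → monic (0# ∷ coeffs n) x ≡ ∑F.∑< (suc n) (λ i → pow x (2 ℕ.^ i))
    monic-coeffs zero    x = +-comm 0# (x * 1#)
    monic-coeffs (suc n) x = begin
      0# + x * (1# + x * monic (expand (coeffs n)) x)
        ≡⟨ cong (λ z → 0# + x * (1# + x * z)) (monic-expand (coeffs n) x) ⟩
      0# + x * (1# + x * monic (coeffs n) (x * x))
        ≡⟨ solve 2 (λ x m → con 0 :+ x :* (con 1 :+ x :* m) := x :* con 1 :+ (con 0 :+ x :* x :* m)) refl x (monic (coeffs n) (x * x)) ⟩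
      x * 1# + monic (0# ∷ coeffs n) (x * x)
        ≡⟨ cong (x * 1# +_) (monic-coeffs n (x * x)) ⟩
      x * 1# + ∑F.∑< (suc n) (λ i → pow (x * x) (2 ℕ.^ i))
        ≡⟨ cong (x * 1# +_) (∑F.∑-cong (upTo (suc n)) (λ i → sym (pow-2^suc x i))) ⟩
      x * 1# + ∑F.∑< (suc n) (λ i → pow x (2 ℕ.^ suc i))
        ≡⟨ ∑F.∑<-suc (suc n) (λ i → pow x (2 ℕ.^ i)) ⟨
      ∑F.∑< (suc (suc n)) (λ i → pow x (2 ℕ.^ i)) ∎

-- The character λ, Kloosterman sums and the formula for σ(m,q;β).

module Characters (r′ : ℕ) (K : GF2^ (suc r′)) where
  open GF2^ K using (F; 0#; 1#; _⁻¹; ⁻¹-inverse; isCommutativeRing) renaming (_+_ to _⊕_; _*_ to _⊛_)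
  open FF K
  open import Data.Integer using (+_; _+_; _*_; _^_; -_; _-_)
  open ∑ℤ
  open IntegerSums
  open BinaryField r′ K
  open IsCommutativeRing isCommutativeRing using (distribˡ; zeroˡ; zeroʳ; *-assoc; +-identityˡ; +-identityʳ; *-identityˡ)
    renaming (*-comm to ⊛-comm)

  isZero-true : ∀ {x} → x ≡ 0# → isZero x ≡ true
  isZero-true {x} = dec-true (x ≟ 0#)

  isZero-false : ∀ {x} → x ≢ 0# → isZero x ≡ false
  isZero-false {x} = dec-false (x ≟ 0#)

  isZero-⊕ : ∀ x y → isZero (x ⊕ y) ≡ does (x ≟ y)
  isZero-⊕ x y with x ≟ y
  ... | yes refl = isZero-true (x+x≡0 x)
  ... | no x≢y   = isZero-false (x≢y ∘ x+y≡0⇒x≡y)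

  tr≡0⇒λ'≡1 : ∀ {x} → tr x ≡ 0# → λ' x ≡ 1ℤ
  tr≡0⇒λ'≡1 p = cong (λ b → if b then 1ℤ else -1ℤ) (isZero-true p)

  tr≢0⇒λ'≡-1 : ∀ {x} → tr x ≢ 0# → λ' x ≡ -1ℤ
  tr≢0⇒λ'≡-1 p = cong (λ b → if b then 1ℤ else -1ℤ) (isZero-false p)

  λ'-0 : λ' 0# ≡ 1ℤ
  λ'-0 = tr≡0⇒λ'≡1 tr-0

  λ'-cong-tr : ∀ {x y} → tr x ≡ tr y → λ' x ≡ λ' y
  λ'-cong-tr = cong (λ t → if isZero t then 1ℤ else -1ℤ)

  λ'-sq : ∀ x → λ' (x ⊛ x) ≡ λ' x
  λ'-sq x = λ'-cong-tr (tr-sq x)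

  λ'-⊕ : ∀ x y → λ' (x ⊕ y) ≡ λ' x * λ' y
  λ'-⊕ x y with tr≡0∨1 x | tr≡0∨1 y
  ... | inj₁ p | _ = begin
    λ' (x ⊕ y)    ≡⟨ λ'-cong-tr (trans (tr-+ x y) (trans (cong (_⊕ tr y) p) (+-identityˡ (tr y)))) ⟩
    λ' y          ≡⟨ ℤ.*-identityˡ (λ' y) ⟨
    1ℤ * λ' y     ≡⟨ cong (_* λ' y) (tr≡0⇒λ'≡1 p) ⟨
    λ' x * λ' y   ∎
  ... | inj₂ _ | inj₁ p = begin
    λ' (x ⊕ y)    ≡⟨ λ'-cong-tr (trans (tr-+ x y) (trans (cong (tr x ⊕_) p) (+-identityʳ (tr x)))) ⟩
    λ' x          ≡⟨ ℤ.*-identityʳ (λ' x) ⟨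
    λ' x * 1ℤ     ≡⟨ cong (λ' x *_) (tr≡0⇒λ'≡1 p) ⟨
    λ' x * λ' y   ∎
  ... | inj₂ p | inj₂ p′ = begin
    λ' (x ⊕ y)    ≡⟨ tr≡0⇒λ'≡1 (trans (tr-+ x y) (trans (cong₂ _⊕_ p p′) 1+1≡0)) ⟩
    -1ℤ * -1ℤ     ≡⟨ cong₂ _*_ (tr≢0⇒λ'≡-1 (1≢0 p)) (tr≢0⇒λ'≡-1 (1≢0 p′)) ⟨
    λ' x * λ' y   ∎
    where
    1≢0 : ∀ {t} → t ≡ 1# → t ≢ 0#
    1≢0 refl = GF2^.0≢1 K ∘ sym

  -- Translation by an element of nonzero trace permutes F and negates every term, so the sum equals
  -- its own negative.
  ∑-λ' : ∑ elems λ' ≡ 0ℤ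
  ∑-λ' with tr-nonzero
  ... | b , tr-b≢0 = i≡-i⇒i≡0 (∑ elems λ') (begin
    ∑ elems λ'                  ≡⟨ ∑-elems-↭ (_⊕ b) (_⊕ b) (λ x → x+y+y≡x x b) (λ x → x+y+y≡x x b) λ' ⟨
    ∑ elems (λ x → λ' (x ⊕ b))  ≡⟨ ∑-cong elems (λ x → trans (λ'-⊕ x b) (cong (λ' x *_) (tr≢0⇒λ'≡-1 tr-b≢0))) ⟩
    ∑ elems (λ x → λ' x * -1ℤ)  ≡⟨ ∑-* elems λ' -1ℤ ⟩
    ∑ elems λ' * -1ℤ            ≡⟨ trans (ℤ.*-comm (∑ elems λ') -1ℤ) (ℤ.-1*i≡-i (∑ elems λ')) ⟩
    - ∑ elems λ'                ∎)

  -- For s ≠ 0 the map a ↦ a s permutes F, which reduces the sum to `∑-λ'`; for s = 0 all q terms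
  -- are 1.
  orthogonality : ∀ s → ∑ elems (λ a → λ' (a ⊛ s)) ≡ (if isZero s then + q else 0ℤ)
  orthogonality s with s ≟ 0#
  ... | yes refl = begin
    ∑ elems (λ a → λ' (a ⊛ 0#))  ≡⟨ ∑-cong elems (λ a → trans (cong λ' (zeroʳ a)) λ'-0) ⟩
    ∑ elems (λ _ → 1ℤ)           ≡⟨ ∑-1 elems ⟩
    + length elems               ≡⟨ cong +_ length-elems ⟩
    + q                          ∎
  ... | no s≢0 = trans (∑-elems-↭ (_⊛ s) (_⊛ (s ⁻¹)) (cancel s⁻¹s) (cancel (⁻¹-inverse s s≢0)) λ') ∑-λ'
    where
    s⁻¹s : (s ⁻¹) ⊛ s ≡ 1#
    s⁻¹s = trans (⊛-comm (s ⁻¹) s) (⁻¹-inverse s s≢0)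
    cancel : ∀ {s t} → s ⊛ t ≡ 1# → ∀ x → x ⊛ s ⊛ t ≡ x
    cancel {s} {t} st≡1 x = trans (*-assoc x s t) (trans (cong (x ⊛_) st≡1) (IsCommutativeRing.*-identityʳ isCommutativeRing x))

  Σ*-λ' : Σ* λ' ≡ -1ℤ
  Σ*-λ' = begin
    Σ* λ'                     ≡⟨ rearrange (Σ* λ') ⟨
    -1ℤ + (1ℤ + Σ* λ')        ≡⟨ cong (λ z → -1ℤ + (z + Σ* λ')) λ'-0 ⟨
    -1ℤ + (λ' 0# + Σ* λ')     ≡⟨ cong (λ z → -1ℤ + z) (∑-elems λ') ⟨
    -1ℤ + ∑ elems λ'          ≡⟨ cong (λ z → -1ℤ + z) ∑-λ' ⟩
    -1ℤ                       ∎
    where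
    rearrange : ∀ x → -1ℤ + (1ℤ + x) ≡ x
    rearrange = ℤSolver.solve-∀

  -- Substituting α = β² a⁻¹ turns a (α + α⁻¹) into the square of β + a β⁻¹, which has the same trace.
  Kl-scaled : ∀ {a} → a ≢ 0# → Σ* (λ α → λ' (a ⊛ (α ⊕ (α ⁻¹)))) ≡ Kl a
  Kl-scaled {a} a≢0 = trans
    (sym (∑-elems*-↭ f g f∘g g∘f f0≡0 (λ α → λ' (a ⊛ (α ⊕ (α ⁻¹))))))
    (∑-cong∈ elems* (λ {β} β∈ → trans (cong λ' (substituted (∈-elems*⇒≢0 β∈))) (λ'-sq (β ⊕ a ⊛ (β ⁻¹)))))
    where
    -- `f` solves a α = β² for α and `g` solves it for β; the latter works for every α because
    -- squaring is invertible on F.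
    f g : F → F
    f β = (β ⊛ β) ⊛ (a ⁻¹)
    g α = sqrt (a ⊛ α)
    a⊛f : ∀ β → a ⊛ f β ≡ β ⊛ β
    a⊛f β = begin
      a ⊛ ((β ⊛ β) ⊛ (a ⁻¹))  ≡⟨ cong (a ⊛_) (⊛-comm (β ⊛ β) (a ⁻¹)) ⟩
      a ⊛ ((a ⁻¹) ⊛ (β ⊛ β))  ≡⟨ *-assoc a (a ⁻¹) (β ⊛ β) ⟨
      a ⊛ (a ⁻¹) ⊛ (β ⊛ β)    ≡⟨ cong (_⊛ (β ⊛ β)) (⁻¹-inverse a a≢0) ⟩
      1# ⊛ (β ⊛ β)            ≡⟨ *-identityˡ (β ⊛ β) ⟩
      β ⊛ β                   ∎
    f0≡0 : f 0# ≡ 0#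
    f0≡0 = trans (cong (_⊛ (a ⁻¹)) (zeroˡ 0#)) (zeroˡ (a ⁻¹))
    f∘g : ∀ α → f (g α) ≡ α
    f∘g α = *-cancelˡ a≢0 (trans (a⊛f (g α)) (sq-sqrt (a ⊛ α)))
    g∘f : ∀ β → g (f β) ≡ β
    g∘f β = trans (cong sqrt (a⊛f β)) (sqrt-sq β)
    ⊛-interchange : ∀ x y z w → (x ⊛ y) ⊛ (z ⊛ w) ≡ (x ⊛ z) ⊛ (y ⊛ w)
    ⊛-interchange x y z w = begin
      (x ⊛ y) ⊛ (z ⊛ w)   ≡⟨ *-assoc x y (z ⊛ w) ⟩
      x ⊛ (y ⊛ (z ⊛ w))   ≡⟨ cong (x ⊛_) (*-assoc y z w) ⟨
      x ⊛ (y ⊛ z ⊛ w)     ≡⟨ cong (λ p → x ⊛ (p ⊛ w)) (⊛-comm y z) ⟩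
      x ⊛ (z ⊛ y ⊛ w)     ≡⟨ cong (x ⊛_) (*-assoc z y w) ⟩
      x ⊛ (z ⊛ (y ⊛ w))   ≡⟨ *-assoc x z (y ⊛ w) ⟨
      (x ⊛ z) ⊛ (y ⊛ w)   ∎
    module _ {β} (β≢0 : β ≢ 0#) where
      γ : F
      γ = a ⊛ (β ⁻¹)
      β⊛γ : β ⊛ γ ≡ a
      β⊛γ = *-cancelˡ β≢0 (begin
        β ⊛ (β ⊛ (a ⊛ (β ⁻¹)))    ≡⟨ cong (λ z → β ⊛ (β ⊛ z)) (⊛-comm a (β ⁻¹)) ⟩
        β ⊛ (β ⊛ ((β ⁻¹) ⊛ a))    ≡⟨ cong (β ⊛_) (*-assoc β (β ⁻¹) a) ⟨
        β ⊛ (β ⊛ (β ⁻¹) ⊛ a)      ≡⟨ cong (λ z → β ⊛ (z ⊛ a)) (⁻¹-inverse β β≢0) ⟩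
        β ⊛ (1# ⊛ a)              ≡⟨ cong (β ⊛_) (*-identityˡ a) ⟩
        β ⊛ a                     ∎)
      fβ≢0 : f β ≢ 0#
      fβ≢0 fβ≡0 = *-nonzero β≢0 β≢0 (trans (sym (a⊛f β)) (trans (cong (a ⊛_) fβ≡0) (zeroʳ a)))
      -- After multiplication by `a` and `f β` both sides are a², because a (f β) = β² and β γ = a.
      a⊛[fβ]⁻¹ : a ⊛ (f β ⁻¹) ≡ γ ⊛ γ
      a⊛[fβ]⁻¹ = *-cancelˡ fβ≢0 (*-cancelˡ a≢0 (begin
        a ⊛ (f β ⊛ (a ⊛ (f β ⁻¹)))    ≡⟨ cong (λ z → a ⊛ (f β ⊛ z)) (⊛-comm a (f β ⁻¹)) ⟩
        a ⊛ (f β ⊛ ((f β ⁻¹) ⊛ a))    ≡⟨ cong (a ⊛_) (*-assoc (f β) (f β ⁻¹) a) ⟨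
        a ⊛ (f β ⊛ (f β ⁻¹) ⊛ a)      ≡⟨ cong (λ z → a ⊛ (z ⊛ a)) (⁻¹-inverse (f β) fβ≢0) ⟩
        a ⊛ (1# ⊛ a)                  ≡⟨ cong (a ⊛_) (*-identityˡ a) ⟩
        a ⊛ a                         ≡⟨ cong₂ _⊛_ β⊛γ β⊛γ ⟨
        (β ⊛ γ) ⊛ (β ⊛ γ)             ≡⟨ ⊛-interchange β γ β γ ⟩
        (β ⊛ β) ⊛ (γ ⊛ γ)             ≡⟨ cong (_⊛ (γ ⊛ γ)) (a⊛f β) ⟨
        a ⊛ f β ⊛ (γ ⊛ γ)             ≡⟨ *-assoc a (f β) (γ ⊛ γ) ⟩
        a ⊛ (f β ⊛ (γ ⊛ γ))           ∎))
      substituted : a ⊛ (f β ⊕ (f β ⁻¹)) ≡ (β ⊕ γ) ⊛ (β ⊕ γ)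
      substituted = begin
        a ⊛ (f β ⊕ (f β ⁻¹))          ≡⟨ distribˡ a (f β) (f β ⁻¹) ⟩
        a ⊛ f β ⊕ a ⊛ (f β ⁻¹)        ≡⟨ cong₂ _⊕_ (a⊛f β) a⊛[fβ]⁻¹ ⟩
        β ⊛ β ⊕ γ ⊛ γ                 ≡⟨ sq-+ β γ ⟨
        (β ⊕ γ) ⊛ (β ⊕ γ)             ∎

  -- Distributivity turns an m-fold sum of products into an m-th power. The function `φ` lives on
  -- all lengths and its factorisation is a hypothesis, so characters of coordinate sums fit
  -- directly.
  ∑-tuples : (f : F → ℤ) (φ : ∀ {m} → Vec F m → ℤ) → φ [] ≡ 1ℤ → (∀ {m} x (v : Vec F m) → φ (x ∷ v) ≡ f x * φ v) →
    ∀ m → ∑ (tuples m) φ ≡ Σ* f ^ m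
  ∑-tuples f φ φ-[] φ-∷ zero    = trans (ℤ.+-identityʳ (φ [])) φ-[]
  ∑-tuples f φ φ-[] φ-∷ (suc m) = begin
    ∑ (tuples (suc m)) φ                                ≡⟨ ∑-product elems* (tuples m) _∷_ φ ⟩
    ∑ elems* (λ x → ∑ (tuples m) (λ v → φ (x ∷ v)))     ≡⟨ ∑-cong elems* (λ x → trans (∑-cong (tuples m) (φ-∷ x)) (*-∑ (tuples m) (f x) φ)) ⟩
    ∑ elems* (λ x → f x * ∑ (tuples m) φ)               ≡⟨ ∑-* elems* f (∑ (tuples m) φ) ⟩
    Σ* f * ∑ (tuples m) φ                               ≡⟨ cong (Σ* f *_) (∑-tuples f φ φ-[] φ-∷ m) ⟩
    Σ* f * Σ* f ^ m                                     ∎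

  N₂≡[q∸1]^m : ∀ m → N₂ m ≡ (q ∸ 1) ℕ.^ m
  N₂≡[q∸1]^m m = ℤ.+-injective (begin
    + N₂ m                       ≡⟨ ∑-1 (tuples m) ⟨
    ∑ (tuples m) (λ _ → 1ℤ)      ≡⟨ ∑-tuples (λ _ → 1ℤ) (λ _ → 1ℤ) refl (λ _ _ → refl) m ⟩
    Σ* (λ _ → 1ℤ) ^ m            ≡⟨ cong (_^ m) (trans (∑-1 elems*) (cong (λ n → + (n ∸ 1)) length-elems*)) ⟩
    (+ (q ∸ 1)) ^ m              ≡⟨ pos-^ (q ∸ 1) m ⟨
    + ((q ∸ 1) ℕ.^ m)            ∎)

  private
    point : ∀ {m} → Vec F m → F
    point v = vsum v ⊕ vinvsum v

    ⊕-interchange : ∀ x y z w → (x ⊕ y) ⊕ (z ⊕ w) ≡ (x ⊕ z) ⊕ (y ⊕ w)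
    ⊕-interchange = ∑F.+-interchange

  λ'-⊛-⊕ : ∀ a x y → λ' (a ⊛ (x ⊕ y)) ≡ λ' (a ⊛ x) * λ' (a ⊛ y)
  λ'-⊛-⊕ a x y = trans (cong λ' (distribˡ a x y)) (λ'-⊕ (a ⊛ x) (a ⊛ y))

  λ'-0⊛ : ∀ x → λ' (0# ⊛ x) ≡ 1ℤ
  λ'-0⊛ x = trans (cong λ' (zeroˡ x)) λ'-0

  λ'-⊛0 : ∀ a → λ' (a ⊛ 0#) ≡ 1ℤ
  λ'-⊛0 a = trans (cong λ' (zeroʳ a)) λ'-0

  ∑-tuples-point : ∀ {a} → a ≢ 0# → ∀ m → ∑ (tuples m) (λ v → λ' (a ⊛ (vsum v ⊕ vinvsum v))) ≡ Kl a ^ m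
  ∑-tuples-point {a} a≢0 m = trans (∑-tuples (λ α → λ' (a ⊛ (α ⊕ (α ⁻¹)))) (λ v → λ' (a ⊛ point v))
      (trans (cong (λ z → λ' (a ⊛ z)) (+-identityˡ 0#)) (λ'-⊛0 a))
      (λ x v → trans (cong (λ z → λ' (a ⊛ z)) (⊕-interchange x (vsum v) (x ⁻¹) (vinvsum v))) (λ'-⊛-⊕ a (x ⊕ (x ⁻¹)) (point v))) m)
    (cong (_^ m) (Kl-scaled a≢0))

  ∑-tuples-0 : ∀ m → ∑ (tuples m) (λ v → λ' (0# ⊛ (vsum v ⊕ vinvsum v))) ≡ + N₂ m
  ∑-tuples-0 m = trans (∑-cong (tuples m) (λ v → λ'-0⊛ (vsum v ⊕ vinvsum v))) (∑-1 (tuples m))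

  module _ (m : ℕ) (β : F) where
    private
      T : List (Vec F m)
      T = tuples m
      twisted : ℤ
      twisted = ∑ elems* (λ a → λ' (a ⊛ β) * Kl a ^ m)

      -- Detects x = β by orthogonality and separates the term a = 0 from the rest.
      detect : (weight : Vec F m → ℤ) (value : Vec F m → F) (c : ℤ) →
        ∑ T weight ≡ c →
        (∀ {a} → a ≢ 0# → ∑ T (λ v → weight v * λ' (a ⊛ value v)) ≡ Kl a ^ m) →
        + q * ∑ T (λ v → if does (value v ≟ β) then weight v else 0ℤ) ≡ c + twisted
      detect weight value c at-0 at-a = begin
        + q * ∑ T (λ v → if does (value v ≟ β) then weight v else 0ℤ)
          ≡⟨ *-∑ T (+ q) (λ v → if does (value v ≟ β) then weight v else 0ℤ) ⟨
        ∑ T (λ v → + q * (if does (value v ≟ β) then weight v else 0ℤ))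
          ≡⟨ ∑-cong T expand ⟩
        ∑ T (λ v → ∑ elems (λ a → weight v * λ' (a ⊛ (value v ⊕ β))))
          ≡⟨ ∑-swap T elems (λ v a → weight v * λ' (a ⊛ (value v ⊕ β))) ⟩
        ∑ elems (λ a → ∑ T (λ v → weight v * λ' (a ⊛ (value v ⊕ β))))
          ≡⟨ ∑-cong elems factor ⟩
        ∑ elems (λ a → λ' (a ⊛ β) * ∑ T (λ v → weight v * λ' (a ⊛ value v)))
          ≡⟨ ∑-elems (λ a → λ' (a ⊛ β) * ∑ T (λ v → weight v * λ' (a ⊛ value v))) ⟩
        λ' (0# ⊛ β) * ∑ T (λ v → weight v * λ' (0# ⊛ value v)) + ∑ elems* (λ a → λ' (a ⊛ β) * ∑ T (λ v → weight v * λ' (a ⊛ value v)))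
          ≡⟨ cong₂ _+_ zero-term (∑-cong∈ elems* (λ {a} a∈ → cong (λ' (a ⊛ β) *_) (at-a (∈-elems*⇒≢0 a∈)))) ⟩
        c + twisted ∎
        where
        expand : ∀ v → + q * (if does (value v ≟ β) then weight v else 0ℤ) ≡ ∑ elems (λ a → weight v * λ' (a ⊛ (value v ⊕ β)))
        expand v = begin
          + q * (if does (value v ≟ β) then weight v else 0ℤ)     ≡⟨ swap-if (does (value v ≟ β)) ⟩
          weight v * (if does (value v ≟ β) then + q else 0ℤ)     ≡⟨ cong (λ b → weight v * (if b then + q else 0ℤ)) (isZero-⊕ (value v) β) ⟨
          weight v * (if isZero (value v ⊕ β) then + q else 0ℤ)   ≡⟨ cong (weight v *_) (orthogonality (value v ⊕ β)) ⟨
          weight v * ∑ elems (λ a → λ' (a ⊛ (value v ⊕ β)))       ≡⟨ *-∑ elems (weight v) (λ a → λ' (a ⊛ (value v ⊕ β))) ⟨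
          ∑ elems (λ a → weight v * λ' (a ⊛ (value v ⊕ β)))       ∎
          where
          swap-if : ∀ b → + q * (if b then weight v else 0ℤ) ≡ weight v * (if b then + q else 0ℤ)
          swap-if true  = ℤ.*-comm (+ q) (weight v)
          swap-if false = trans (ℤ.*-zeroʳ (+ q)) (sym (ℤ.*-zeroʳ (weight v)))
        rearrange : ∀ x y z → x * (y * z) ≡ z * (x * y)
        rearrange = ℤSolver.solve-∀
        factor : ∀ a → ∑ T (λ v → weight v * λ' (a ⊛ (value v ⊕ β))) ≡ λ' (a ⊛ β) * ∑ T (λ v → weight v * λ' (a ⊛ value v))
        factor a = trans
          (∑-cong T (λ v → trans (cong (weight v *_) (λ'-⊛-⊕ a (value v) β)) (rearrange (weight v) (λ' (a ⊛ value v)) (λ' (a ⊛ β)))))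
          (*-∑ T (λ' (a ⊛ β)) (λ v → weight v * λ' (a ⊛ value v)))
        zero-term : λ' (0# ⊛ β) * ∑ T (λ v → weight v * λ' (0# ⊛ value v)) ≡ c
        zero-term = begin
          λ' (0# ⊛ β) * ∑ T (λ v → weight v * λ' (0# ⊛ value v))
            ≡⟨ cong₂ _*_ (λ'-0⊛ β) (∑-cong T (λ v → trans (cong (weight v *_) (λ'-0⊛ (value v))) (ℤ.*-identityʳ (weight v)))) ⟩
          1ℤ * ∑ T weight                                         ≡⟨ ℤ.*-identityˡ (∑ T weight) ⟩
          ∑ T weight                                              ≡⟨ at-0 ⟩
          c                                                       ∎

    -- With weight 1 the term a = 0 counts all tuples, and the remaining inner sums are powers of
    -- K(λ;a) through the substitution in `Kl-scaled`.
    q*σ : + q * + σ m β ≡ + N₂ m + twisted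
    q*σ = trans (cong (+ q *_) (trans (pos-∑ T (λ v → if does (point v ≟ β) then 1 else 0)) (∑-cong T (λ v → pos-if (does (point v ≟ β))))))
      (detect (λ _ → 1ℤ) point (+ N₂ m) (∑-1 T)
        (λ {a} a≢0 → trans (∑-cong T (λ v → ℤ.*-identityˡ (λ' (a ⊛ point v)))) (∑-tuples-point a≢0 m)))
      where
      pos-if : ∀ b → + (if b then 1 else 0) ≡ (if b then 1ℤ else 0ℤ)
      pos-if true  = refl
      pos-if false = refl

    -- With weight λ(Σ αᵢ) each one-variable factor is Σ λ(α + a α⁻¹), already K(λ;a) by definition.
    -- The term a = 0 is (-1)^m, since λ sums to -1 over the units.
    q*σsum : + q * σsum m β ≡ -1ℤ ^ m + twisted
    q*σsum = detect (λ v → λ' (vsum v)) vinvsum (-1ℤ ^ m)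
      (trans (∑-tuples λ' (λ v → λ' (vsum v)) λ'-0 (λ x v → λ'-⊕ x (vsum v)) m) (cong (_^ m) Σ*-λ'))
      (λ {a} _ → ∑-tuples (λ α → λ' (α ⊕ a ⊛ (α ⁻¹))) (λ v → λ' (vsum v) * λ' (a ⊛ vinvsum v))
        (cong₂ _*_ λ'-0 (λ'-⊛0 a)) (split a) m)
      where
      interchange : ∀ x y z w → (x * y) * (z * w) ≡ (x * z) * (y * w)
      interchange = ℤSolver.solve-∀
      split : ∀ a {m} x (v : Vec F m) → λ' (x ⊕ vsum v) * λ' (a ⊛ ((x ⁻¹) ⊕ vinvsum v))
        ≡ λ' (x ⊕ a ⊛ (x ⁻¹)) * (λ' (vsum v) * λ' (a ⊛ vinvsum v))
      split a x v = begin
        λ' (x ⊕ vsum v) * λ' (a ⊛ ((x ⁻¹) ⊕ vinvsum v))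
          ≡⟨ cong₂ _*_ (λ'-⊕ x (vsum v)) (λ'-⊛-⊕ a (x ⁻¹) (vinvsum v)) ⟩
        (λ' x * λ' (vsum v)) * (λ' (a ⊛ (x ⁻¹)) * λ' (a ⊛ vinvsum v))
          ≡⟨ interchange (λ' x) (λ' (vsum v)) (λ' (a ⊛ (x ⁻¹))) (λ' (a ⊛ vinvsum v)) ⟩
        (λ' x * λ' (a ⊛ (x ⁻¹))) * (λ' (vsum v) * λ' (a ⊛ vinvsum v))
          ≡⟨ cong (_* (λ' (vsum v) * λ' (a ⊛ vinvsum v))) (λ'-⊕ x (a ⊛ (x ⁻¹))) ⟨
        λ' (x ⊕ a ⊛ (x ⁻¹)) * (λ' (vsum v) * λ' (a ⊛ vinvsum v)) ∎

    -- The sum `twisted` is common to both counts, so they differ only in their terms at a = 0,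
    -- namely (q-1)^m and (-1)^m.
    σ-formula : + q * + σ m β ≡ + q * σsum m β + (+ ((q ∸ 1) ℕ.^ m) + sign (m ℕ.+ 1))
    σ-formula = begin
      + q * + σ m β                                            ≡⟨ q*σ ⟩
      + N₂ m + twisted                                         ≡⟨ rearrange (+ N₂ m) twisted (-1ℤ ^ m) ⟩
      -1ℤ ^ m + twisted + (+ N₂ m + -1ℤ ^ m * -1ℤ)             ≡⟨ cong₂ (λ x y → x + (+ N₂ m + y)) (sym q*σsum) (sym (ℤ.^-distribˡ-+-* -1ℤ m 1)) ⟩
      + q * σsum m β + (+ N₂ m + sign (m ℕ.+ 1))               ≡⟨ cong (λ n → + q * σsum m β + (+ n + sign (m ℕ.+ 1))) (N₂≡[q∸1]^m m) ⟩
      + q * σsum m β + (+ ((q ∸ 1) ℕ.^ m) + sign (m ℕ.+ 1))    ∎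
      where
      rearrange : ∀ n t s → n + t ≡ s + t + (n + s * -1ℤ)
      rearrange = ℤSolver.solve-∀

-- Codewords grouped by the values gᵢ of their coordinates: the formula for D_{m,j}.

module WeightEnumerator (r′ : ℕ) (K : GF2^ (suc r′)) where
  open GF2^ K using (F; 0#; enum; isCommutativeRing) renaming (_+_ to _⊕_)
  open FF K
  open BinaryField r′ K
  open IsCommutativeRing isCommutativeRing using (+-identityˡ)
    renaming (+-comm to ⊕-comm; +-assoc to ⊕-assoc)
  open ∑ℕ

  -- multisum n b x φ = Σ over 0 ≤ ν ≤ b of Π C(b i, ν i) · φ (Σ ν i) (Σ ν i · x i).
  multisum : ∀ n → (Fin n → ℕ) → (Fin n → F) → (ℕ → F → ℕ) → ℕ
  multisum zero    b x φ = φ 0 0#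
  multisum (suc n) b x φ = ∑< (suc (b zero)) (λ k →
    (b zero C k) ℕ.* multisum n (b ∘ suc) (x ∘ suc) (λ j s → φ (k ℕ.+ j) ((k · x zero) ⊕ s)))

  multisum-cong : ∀ n {b b′} x {φ ψ} → (∀ i → b i ≡ b′ i) → (∀ j s → φ j s ≡ ψ j s) →
    multisum n b x φ ≡ multisum n b′ x ψ
  multisum-cong zero             x eq eqφ = eqφ 0 0#
  multisum-cong (suc n) {b} {b′} x {φ} {ψ} eq eqφ = trans
    (∑-cong (upTo (suc (b zero))) (λ k → cong ((b zero C k) ℕ.*_)
      (multisum-cong n (x ∘ suc) (eq ∘ suc) (λ j s → eqφ (k ℕ.+ j) ((k · x zero) ⊕ s)))))
    (cong (λ c → ∑< (suc c) (λ k → (c C k) ℕ.* multisum n (b′ ∘ suc) (x ∘ suc) (λ j s → ψ (k ℕ.+ j) ((k · x zero) ⊕ s)))) (eq zero))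

  multisum-0 : ∀ n x φ → multisum n (λ _ → 0) x φ ≡ φ 0 0#
  multisum-0 zero    x φ = refl
  multisum-0 (suc n) x φ = begin
    1 ℕ.* multisum n (λ _ → 0) (x ∘ suc) (λ j s → φ j (0# ⊕ s)) ℕ.+ 0
      ≡⟨ ℕ.+-identityʳ _ ⟩
    1 ℕ.* multisum n (λ _ → 0) (x ∘ suc) (λ j s → φ j (0# ⊕ s))
      ≡⟨ ℕ.*-identityˡ _ ⟩
    multisum n (λ _ → 0) (x ∘ suc) (λ j s → φ j (0# ⊕ s))
      ≡⟨ multisum-0 n (x ∘ suc) (λ j s → φ j (0# ⊕ s)) ⟩
    φ 0 (0# ⊕ 0#)
      ≡⟨ cong (φ 0) (+-identityˡ 0#) ⟩
    φ 0 0# ∎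

  -- Pascal's rule in the i-th coordinate.
  multisum-suc : ∀ n {b b′ : Fin n → ℕ} x φ i → b′ i ≡ suc (b i) → (∀ k → k ≢ i → b′ k ≡ b k) →
    multisum n b′ x φ ≡ multisum n b x φ ℕ.+ multisum n b x (λ j s → φ (suc j) (x i ⊕ s))
  multisum-suc (suc n) {b} {b′} x φ zero b′i b′k = begin
    ∑< (suc (b′ zero)) (λ k → (b′ zero C k) ℕ.* multisum n (b′ ∘ suc) (x ∘ suc) (φ′ k))
      ≡⟨ cong (λ c → ∑< (suc c) (λ k → (c C k) ℕ.* multisum n (b′ ∘ suc) (x ∘ suc) (φ′ k))) b′i ⟩
    ∑< (2 ℕ.+ b zero) (λ k → (suc (b zero) C k) ℕ.* multisum n (b′ ∘ suc) (x ∘ suc) (φ′ k))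
      ≡⟨ ∑-cong (upTo (2 ℕ.+ b zero)) (λ k → cong ((suc (b zero) C k) ℕ.*_)
           (multisum-cong n (x ∘ suc) (λ i → b′k (suc i) (λ ())) (λ _ _ → refl))) ⟩
    ∑< (2 ℕ.+ b zero) (λ k → (suc (b zero) C k) ℕ.* M k)
      ≡⟨ ∑<-pascal id refl (λ _ _ → refl) (b zero) M ⟩
    ∑< (suc (b zero)) (λ k → (b zero C k) ℕ.* (M k ℕ.+ M (suc k)))
      ≡⟨ ∑-cong (upTo (suc (b zero))) (λ k → trans
           (cong (λ z → (b zero C k) ℕ.* (M k ℕ.+ z)) (shifted k))
           (ℕ.*-distribˡ-+ (b zero C k) (M k) (M′ k))) ⟩
    ∑< (suc (b zero)) (λ k → (b zero C k) ℕ.* M k ℕ.+ (b zero C k) ℕ.* M′ k)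
      ≡⟨ ∑-+ (upTo (suc (b zero))) (λ k → (b zero C k) ℕ.* M k) (λ k → (b zero C k) ℕ.* M′ k) ⟩
    multisum (suc n) b x φ ℕ.+ multisum (suc n) b x (λ j s → φ (suc j) (x zero ⊕ s)) ∎
    where
    φ′ : ℕ → ℕ → F → ℕ
    φ′ k j s = φ (k ℕ.+ j) ((k · x zero) ⊕ s)
    M M′ : ℕ → ℕ
    M k  = multisum n (b ∘ suc) (x ∘ suc) (φ′ k)
    M′ k = multisum n (b ∘ suc) (x ∘ suc) (λ j s → φ (suc (k ℕ.+ j)) (x zero ⊕ ((k · x zero) ⊕ s)))
    shifted : ∀ k → M (suc k) ≡ M′ k
    shifted k = multisum-cong n (x ∘ suc) (λ _ → refl) (λ j s → cong (φ (suc (k ℕ.+ j))) (⊕-assoc (x zero) (k · x zero) s))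
  multisum-suc (suc n) {b} {b′} x φ (suc i) b′i b′k = begin
    ∑< (suc (b′ zero)) (λ k → (b′ zero C k) ℕ.* multisum n (b′ ∘ suc) (x ∘ suc) (φ′ k))
      ≡⟨ cong (λ c → ∑< (suc c) (λ k → (c C k) ℕ.* multisum n (b′ ∘ suc) (x ∘ suc) (φ′ k))) (b′k zero (λ ())) ⟩
    ∑< (suc (b zero)) (λ k → (b zero C k) ℕ.* multisum n (b′ ∘ suc) (x ∘ suc) (φ′ k))
      ≡⟨ ∑-cong (upTo (suc (b zero))) (λ k → trans (cong ((b zero C k) ℕ.*_) (step k)) (ℕ.*-distribˡ-+ (b zero C k) (M k) (M′ k))) ⟩
    ∑< (suc (b zero)) (λ k → (b zero C k) ℕ.* M k ℕ.+ (b zero C k) ℕ.* M′ k)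
      ≡⟨ ∑-+ (upTo (suc (b zero))) (λ k → (b zero C k) ℕ.* M k) (λ k → (b zero C k) ℕ.* M′ k) ⟩
    multisum (suc n) b x φ ℕ.+ multisum (suc n) b x (λ j s → φ (suc j) (x (suc i) ⊕ s)) ∎
    where
    φ′ : ℕ → ℕ → F → ℕ
    φ′ k j s = φ (k ℕ.+ j) ((k · x zero) ⊕ s)
    M M′ : ℕ → ℕ
    M k  = multisum n (b ∘ suc) (x ∘ suc) (φ′ k)
    M′ k = multisum n (b ∘ suc) (x ∘ suc) (λ j s → φ (suc (k ℕ.+ j)) (x (suc i) ⊕ ((k · x zero) ⊕ s)))
    swap : ∀ x y z → x ⊕ (y ⊕ z) ≡ y ⊕ (x ⊕ z)
    swap x y z = trans (sym (⊕-assoc x y z)) (trans (cong (_⊕ z) (⊕-comm x y)) (⊕-assoc y x z))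
    step : ∀ k → multisum n (b′ ∘ suc) (x ∘ suc) (φ′ k) ≡ M k ℕ.+ M′ k
    step k = trans (multisum-suc n (x ∘ suc) (φ′ k) i b′i (λ l l≢i → b′k (suc l) (l≢i ∘ suc-injective)))
      (cong (M k ℕ.+_) (multisum-cong n (x ∘ suc) (λ _ → refl)
        (λ j s → cong₂ φ (ℕ.+-suc k j) (swap (k · x zero) (x (suc i)) s))))

  -- The map `e` lets the induction drop leading coordinates while the binomial factors still refer
  -- to the full index set; it starts as the identity.
  ∑-bounded : ∀ {n N} (e : Fin n → Fin N) (b : Fin N → ℕ) x φ →
    ∑ (bounded (Vec.tabulate (b ∘ e))) (λ ν →
      Vec.foldr _ ℕ._*_ 1 (Vec.zipWith (λ i k → b i C k) (Vec.tabulate e) ν)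
        ℕ.* φ (Vec.sum ν) (vsum (Vec.zipWith _·_ ν (Vec.tabulate x))))
    ≡ multisum n (b ∘ e) x φ
  ∑-bounded {zero}  e b x φ = trans (ℕ.+-identityʳ _) (ℕ.*-identityˡ (φ 0 0#))
  ∑-bounded {suc n} e b x φ = begin
    ∑ (bounded (Vec.tabulate (b ∘ e))) term
      ≡⟨ ∑-product (range 0 (b (e zero))) rest _∷_ term ⟩
    ∑ (range 0 (b (e zero))) (λ k → ∑ rest (λ ν → term (k ∷ ν)))
      ≡⟨ ∑-range 0 (b (e zero)) (λ k → ∑ rest (λ ν → term (k ∷ ν))) ⟩
    ∑< (suc (b (e zero))) (λ k → ∑ rest (λ ν → term (k ∷ ν)))
      ≡⟨ ∑-cong (upTo (suc (b (e zero)))) step ⟩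
    multisum (suc n) (b ∘ e) x φ ∎
    where
    rest : List (Vec ℕ n)
    rest = bounded (Vec.tabulate (b ∘ e ∘ suc))
    term : Vec ℕ (suc n) → ℕ
    term ν = Vec.foldr _ ℕ._*_ 1 (Vec.zipWith (λ i k → b i C k) (Vec.tabulate e) ν)
      ℕ.* φ (Vec.sum ν) (vsum (Vec.zipWith _·_ ν (Vec.tabulate x)))
    step : ∀ k → ∑ rest (λ ν → term (k ∷ ν))
      ≡ (b (e zero) C k) ℕ.* multisum n (b ∘ e ∘ suc) (x ∘ suc) (λ j s → φ (k ℕ.+ j) ((k · x zero) ⊕ s))
    step k = trans
      (trans (∑-cong rest (λ ν → ℕ.*-assoc (b (e zero) C k) (Vec.foldr _ ℕ._*_ 1 (Vec.zipWith (λ i k → b i C k) (Vec.tabulate (e ∘ suc)) ν)) _))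
             (*-∑ rest (b (e zero) C k) _))
      (cong ((b (e zero) C k) ℕ.*_) (∑-bounded (e ∘ suc) b (x ∘ suc) (λ j s → φ (k ℕ.+ j) ((k · x zero) ⊕ s))))

  module _ {V : Set} (f : V → F) where
    private
      count : List V → F → ℕ
      count vs β = ∑ vs (λ v → if does (f v ≟ β) then 1 else 0)

    -- Each new entry v raises the size of one class, that of `f v`, by one. Its bit 0 or 1 then
    -- matches the two summands of Pascal's rule in `multisum-suc`. The function `φ` is arbitrary so
    -- that the induction can absorb the weight and value added by bit 1.
    ∑-allBin : ∀ vs (φ : ℕ → F → ℕ) →
      ∑ (allBin (length vs)) (λ u → φ (wt u) (dot u (Vec.map f (Vec.fromList vs))))
      ≡ multisum q (λ i → count vs (Inverse.to enum i)) (Inverse.to enum) φ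
    ∑-allBin []       φ = trans (ℕ.+-identityʳ (φ 0 0#)) (sym (multisum-0 q (Inverse.to enum) φ))
    ∑-allBin (v ∷ vs) φ = begin
      ∑ (allBin (suc (length vs))) (λ u → φ (wt u) (dot u (f v ∷ g)))
        ≡⟨ ∑-product (false ∷ true ∷ []) (allBin (length vs)) _∷_ (λ u → φ (wt u) (dot u (f v ∷ g))) ⟩
      ∑ (allBin (length vs)) (λ u → φ (wt u) (0# ⊕ dot u g)) ℕ.+ (∑ (allBin (length vs)) (λ u → φ (suc (wt u)) (f v ⊕ dot u g)) ℕ.+ 0)
        ≡⟨ cong₂ ℕ._+_ (trans (∑-cong (allBin (length vs)) (λ u → cong (φ (wt u)) (+-identityˡ (dot u g)))) (∑-allBin vs φ))
             (trans (ℕ.+-identityʳ _) (trans (∑-allBin vs (λ j s → φ (suc j) (f v ⊕ s)))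
               (multisum-cong q (Inverse.to enum) (λ _ → refl) (λ j s → cong (λ y → φ (suc j) (y ⊕ s)) (sym to-i≡fv))))) ⟩
      multisum q (λ i → count vs (Inverse.to enum i)) (Inverse.to enum) φ
        ℕ.+ multisum q (λ i → count vs (Inverse.to enum i)) (Inverse.to enum) (λ j s → φ (suc j) (Inverse.to enum i ⊕ s))
        ≡⟨ multisum-suc q (Inverse.to enum) φ i hit miss ⟨
      multisum q (λ i → count (v ∷ vs) (Inverse.to enum i)) (Inverse.to enum) φ ∎
      where
      g = Vec.map f (Vec.fromList vs)
      i = Inverse.from enum (f v)
      to-i≡fv : Inverse.to enum i ≡ f v
      to-i≡fv = Inverse.inverseˡ enum refl
      hit : count (v ∷ vs) (Inverse.to enum i) ≡ suc (count vs (Inverse.to enum i))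
      hit with f v ≟ Inverse.to enum i
      ... | yes _ = refl
      ... | no ¬p = contradiction (sym to-i≡fv) ¬p
      miss : ∀ k → k ≢ i → count (v ∷ vs) (Inverse.to enum k) ≡ count vs (Inverse.to enum k)
      miss k k≢i with f v ≟ Inverse.to enum k
      ... | yes p = contradiction (sym (Inverse.inverseʳ enum p)) k≢i
      ... | no _  = refl

  D≡Dformula : ∀ m j → D m j ≡ Dformula m j
  D≡Dformula m j = begin
    D m j                                         ≡⟨ ∑-allBin point (tuples m) φ ⟩
    multisum q (σ m ∘ Inverse.to enum) (Inverse.to enum) φ   ≡⟨ ∑-bounded id (σ m ∘ Inverse.to enum) (Inverse.to enum) φ ⟨
    ∑ (families m) (λ ν → P ν ℕ.* φ (Vec.sum ν) (s ν))
      ≡⟨ ∑-cong (families m) (λ ν → *-indicator (P ν) (does (Vec.sum ν ℕ.≟ j) ∧ isZero (s ν))) ⟩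
    Dformula m j ∎
    where
    point : Vec F m → F
    point v = vsum v ⊕ vinvsum v
    φ : ℕ → F → ℕ
    φ k s = if does (k ℕ.≟ j) ∧ isZero s then 1 else 0
    P : Vec ℕ q → ℕ
    P ν = Vec.foldr _ ℕ._*_ 1 (Vec.zipWith (λ i k → σ m (Inverse.to enum i) C k) (Vec.allFin q) ν)
    s : Vec ℕ q → F
    s ν = vsum (Vec.zipWith _·_ ν (Vec.tabulate (Inverse.to enum)))
    *-indicator : ∀ p b → p ℕ.* (if b then 1 else 0) ≡ (if b then p else 0)
    *-indicator p true  = ℕ.*-identityʳ p
    *-indicator p false = ℕ.*-zeroʳ p

-- The Pless power moments and the recursion for MK.

module PowerMoments (r′ : ℕ) (K : GF2^ (suc r′)) where
  open GF2^ K using (F; 0#; isCommutativeRing) renaming (_+_ to _⊕_; _*_ to _⊛_)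
  open FF K
  open import Data.Integer using (+_; _+_; _*_; _^_; -_; _-_)
  open ∑ℤ
  open IntegerSums
  open BinaryField r′ K
  open Characters r′ K
  open IsCommutativeRing isCommutativeRing using (+-identityˡ)

  wt≤n : ∀ {n} (u : Vec Bool n) → wt u ≤ n
  wt≤n []          = z≤n
  wt≤n (false ∷ u) = ℕ.m≤n⇒m≤1+n (wt≤n u)
  wt≤n (true  ∷ u) = s≤s (wt≤n u)

  -- The Hamming weight of the codeword (tr (a gᵢ))ᵢ of the dual code.
  trace-weight : ∀ {n} → F → Vec F n → ℕ
  trace-weight a []      = 0
  trace-weight a (x ∷ g) = if isZero (tr (a ⊛ x)) then trace-weight a g else suc (trace-weight a g)

  -- Each coordinate contributes 1 - λ(a gᵢ), which is 0 for trace 0 and 2 otherwise.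
  2*trace-weight : ∀ {V : Set} (f : V → F) a vs →
    + 2 * + trace-weight a (Vec.map f (Vec.fromList vs)) ≡ + length vs - ∑ vs (λ v → λ' (a ⊛ f v))
  2*trace-weight f a []       = refl
  2*trace-weight f a (v ∷ vs) = step (isZero (tr (a ⊛ f v)))
    where
    W = trace-weight a (Vec.map f (Vec.fromList vs))
    X = ∑ vs (λ v → λ' (a ⊛ f v))
    rearrange₁ : ∀ l x → l - x ≡ 1ℤ + l - (1ℤ + x)
    rearrange₁ = ℤSolver.solve-∀
    rearrange₂ : ∀ w → + 2 * (1ℤ + w) ≡ + 2 + + 2 * w
    rearrange₂ = ℤSolver.solve-∀
    rearrange₃ : ∀ l x → + 2 + (l - x) ≡ 1ℤ + l - (-1ℤ + x)
    rearrange₃ = ℤSolver.solve-∀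
    step : ∀ b → + 2 * + (if b then W else suc W) ≡ + suc (length vs) - ((if b then 1ℤ else -1ℤ) + X)
    step true  = trans (2*trace-weight f a vs) (rearrange₁ (+ length vs) X)
    step false = begin
      + 2 * (1ℤ + + W)                   ≡⟨ rearrange₂ (+ W) ⟩
      + 2 + + 2 * + W                    ≡⟨ cong (λ z → + 2 + z) (2*trace-weight f a vs) ⟩
      + 2 + (+ length vs - X)            ≡⟨ rearrange₃ (+ length vs) X ⟩
      + suc (length vs) - (-1ℤ + X)      ∎

  -- The coefficient of y^t in (-y)^w (1 + y)^(n - w).
  kernel : ℕ → ℕ → ℕ → ℤ
  kernel n w t = sign w * + shiftC (n ∸ w) w t

  kernel-0 : ∀ {n w} → w ≤ n → kernel (suc n) w 0 ≡ kernel n w 0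
  kernel-0 {n} {w} w≤n = cong (λ c → sign w * + c)
    (trans (cong (λ k → shiftC k w 0) (ℕ.+-∸-assoc 1 w≤n)) (shiftC-0 (n ∸ w) w))

  -- A coordinate with bit 0 multiplies the polynomial by 1 + y; the bound on w keeps the
  -- subtraction n - w from being truncated.
  kernel-suc : ∀ {n w} t → w ≤ n → kernel (suc n) w (suc t) ≡ kernel n w t + kernel n w (suc t)
  kernel-suc {n} {w} t w≤n = begin
    sign w * + shiftC (suc n ∸ w) w (suc t)
      ≡⟨ cong (λ k → sign w * + shiftC k w (suc t)) (ℕ.+-∸-assoc 1 w≤n) ⟩
    sign w * + shiftC (suc (n ∸ w)) w (suc t)
      ≡⟨ cong (λ c → sign w * + c) (shiftC-suc (n ∸ w) w t) ⟩
    sign w * (+ shiftC (n ∸ w) w t + + shiftC (n ∸ w) w (suc t))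
      ≡⟨ ℤ.*-distribˡ-+ (sign w) (+ shiftC (n ∸ w) w t) (+ shiftC (n ∸ w) w (suc t)) ⟩
    kernel n w t + kernel n w (suc t) ∎

  -- A coordinate with bit 1 multiplies the polynomial by -y and leaves n - w unchanged.
  kernel-suc-suc : ∀ n w t → kernel (suc n) (suc w) (suc t) ≡ - kernel n w t
  kernel-suc-suc n w t = rearrange (sign w) (+ shiftC (n ∸ w) w t)
    where
    rearrange : ∀ s c → -1ℤ * s * c ≡ - (s * c)
    rearrange = ℤSolver.solve-∀

  -- Coefficient of y^t in Π (1 + y - λ(a gᵢ) y), whose factors are 1 or 1 + 2 y.
  macWilliams : ∀ {n} (g : Vec F n) a t →
    + (2 ℕ.^ t ℕ.* (trace-weight a g C t)) ≡ ∑ (allBin n) (λ u → λ' (a ⊛ dot u g) * kernel n (wt u) t)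
  macWilliams []              a zero    = sym (trans (ℤ.+-identityʳ _) (trans (ℤ.*-identityʳ _) (λ'-⊛0 a)))
  macWilliams []              a (suc t) = trans (cong +_ (trans (cong (2 ℕ.^ suc t ℕ.*_) 0C) (ℕ.*-zeroʳ (2 ℕ.^ suc t))))
    (sym (trans (ℤ.+-identityʳ _) (trans (cong (λ c → λ' (a ⊛ 0#) * (1ℤ * + c)) 0C) (ℤ.*-zeroʳ (λ' (a ⊛ 0#))))))
    where
    0C : 0 C suc t ≡ 0
    0C = k>n⇒nCk≡0 {0} {suc t} (s≤s z≤n)
  macWilliams {suc n} (x ∷ g) a t = trans (main t)
    (sym (∑-product (false ∷ true ∷ []) (allBin n) _∷_ (λ u → λ' (a ⊛ dot u (x ∷ g)) * kernel (suc n) (wt u) t)))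
    where
    c = trace-weight a g
    B = allBin n
    A : ℕ → ℤ
    A t = ∑ B (λ u → λ' (a ⊛ dot u g) * kernel n (wt u) t)
    -- The words with first bit 0 and 1: the former carry the factor 1 + y, the latter the factor
    -- -λ(a x) y.
    A₀ A₁ : ℕ → ℤ
    A₀ t = ∑ B (λ u → λ' (a ⊛ (0# ⊕ dot u g)) * kernel (suc n) (wt u) t)
    A₁ t = ∑ B (λ u → λ' (a ⊛ (x ⊕ dot u g)) * kernel (suc n) (suc (wt u)) t)
    A₀-0 : A₀ 0 ≡ A 0
    A₀-0 = ∑-cong B (λ u → cong₂ _*_ (cong (λ z → λ' (a ⊛ z)) (+-identityˡ (dot u g))) (kernel-0 (wt≤n u)))
    A₁-0 : A₁ 0 ≡ 0ℤ
    A₁-0 = trans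
      (∑-cong B (λ u → trans
        (cong (λ' (a ⊛ (x ⊕ dot u g)) *_) (ℤ.*-zeroʳ (sign (suc (wt u)))))
        (ℤ.*-zeroʳ (λ' (a ⊛ (x ⊕ dot u g))))))
      (∑-zero B)
    A₀-suc : ∀ t → A₀ (suc t) ≡ A t + A (suc t)
    A₀-suc t = trans
      (∑-cong B (λ u → trans
        (cong₂ _*_ (cong (λ z → λ' (a ⊛ z)) (+-identityˡ (dot u g))) (kernel-suc t (wt≤n u)))
        (ℤ.*-distribˡ-+ (λ' (a ⊛ dot u g)) (kernel n (wt u) t) (kernel n (wt u) (suc t)))))
      (∑-+ B (λ u → λ' (a ⊛ dot u g) * kernel n (wt u) t) (λ u → λ' (a ⊛ dot u g) * kernel n (wt u) (suc t)))
    rearrange : ∀ l m k → l * m * - k ≡ - l * (m * k)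
    rearrange = ℤSolver.solve-∀
    A₁-suc : ∀ t → A₁ (suc t) ≡ - λ' (a ⊛ x) * A t
    A₁-suc t = trans
      (∑-cong B (λ u → trans
        (cong₂ _*_ (λ'-⊛-⊕ a x (dot u g)) (kernel-suc-suc n (wt u) t))
        (rearrange (λ' (a ⊛ x)) (λ' (a ⊛ dot u g)) (kernel n (wt u) t))))
      (*-∑ B (- λ' (a ⊛ x)) (λ u → λ' (a ⊛ dot u g) * kernel n (wt u) t))
    -- For λ(a x) = 1 the new factor is 1 and the weight stays. For λ(a x) = -1 it is 1 + 2y, and
    -- Pascal's rule for the weight raised by one supplies the doubled coefficient.
    step : ∀ t b → + (2 ℕ.^ suc t ℕ.* ((if b then c else suc c) C suc t)) ≡ A t + A (suc t) + (- (if b then 1ℤ else -1ℤ) * A t + 0ℤ)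
    step t true  = trans (macWilliams g a (suc t)) (rearrange′ (A t) (A (suc t)))
      where
      rearrange′ : ∀ x y → y ≡ x + y + (- 1ℤ * x + 0ℤ)
      rearrange′ = ℤSolver.solve-∀
    step t false = begin
      + (2 ℕ.^ suc t ℕ.* (suc c C suc t))
        ≡⟨ cong (λ z → + (2 ℕ.^ suc t ℕ.* z)) (nCk+nC[k+1]≡[n+1]C[k+1] c t) ⟨
      + (2 ℕ.^ suc t ℕ.* (c C t ℕ.+ c C suc t))
        ≡⟨ cong +_ (expand (2 ℕ.^ t) (c C t) (c C suc t)) ⟩
      + (2 ℕ.^ t ℕ.* (c C t)) + + (2 ℕ.^ t ℕ.* (c C t)) + + (2 ℕ.^ suc t ℕ.* (c C suc t))
        ≡⟨ cong₂ (λ x y → x + x + y) (macWilliams g a t) (macWilliams g a (suc t)) ⟩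
      A t + A t + A (suc t)
        ≡⟨ rearrange′ (A t) (A (suc t)) ⟩
      A t + A (suc t) + (- -1ℤ * A t + 0ℤ) ∎
      where
      expand : ∀ p x y → 2 ℕ.* p ℕ.* (x ℕ.+ y) ≡ p ℕ.* x ℕ.+ p ℕ.* x ℕ.+ 2 ℕ.* p ℕ.* y
      expand = ℕSolver.solve-∀
      rearrange′ : ∀ x y → x + x + y ≡ x + y + (- -1ℤ * x + 0ℤ)
      rearrange′ = ℤSolver.solve-∀
    main : ∀ t → + (2 ℕ.^ t ℕ.* (trace-weight a (x ∷ g) C t)) ≡ A₀ t + (A₁ t + 0ℤ)
    main zero    = trans (macWilliams g a 0) (sym (trans (cong₂ (λ x y → x + (y + 0ℤ)) A₀-0 A₁-0) (ℤ.+-identityʳ (A 0))))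
    main (suc t) = trans (step t (isZero (tr (a ⊛ x)))) (sym (cong₂ (λ x y → x + (y + 0ℤ)) (A₀-suc t) (A₁-suc t)))

  coeff : ℕ → ℕ → ℕ
  coeff h t = surj h t ℕ.* 2 ℕ.^ (h ∸ t)

  -- Here 2^h is split as 2^(h - t) 2^t, so that 2^t C(c,t) is the coefficient of y^t in (1 + 2y)^c
  -- that `macWilliams` evaluates.
  [2*c]^h : ∀ c h → (+ 2 * + c) ^ h ≡ ∑< (suc h) (λ t → + coeff h t * + (2 ℕ.^ t ℕ.* (c C t)))
  [2*c]^h c h = begin
    (+ 2 * + c) ^ h
      ≡⟨ cong (_^ h) (ℤ.pos-* 2 c) ⟨
    (+ (2 ℕ.* c)) ^ h
      ≡⟨ pos-^ (2 ℕ.* c) h ⟨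
    + ((2 ℕ.* c) ℕ.^ h)
      ≡⟨ cong +_ (trans (*-^ 2 c h) (cong (2 ℕ.^ h ℕ.*_) (^-surj c h))) ⟩
    + (2 ℕ.^ h ℕ.* ∑ℕ.∑< (suc h) (λ t → surj h t ℕ.* (c C t)))
      ≡⟨ cong +_ (∑ℕ.*-∑ (upTo (suc h)) (2 ℕ.^ h) (λ t → surj h t ℕ.* (c C t))) ⟨
    + ∑ℕ.∑< (suc h) (λ t → 2 ℕ.^ h ℕ.* (surj h t ℕ.* (c C t)))
      ≡⟨ pos-∑ (upTo (suc h)) (λ t → 2 ℕ.^ h ℕ.* (surj h t ℕ.* (c C t))) ⟩
    ∑< (suc h) (λ t → + (2 ℕ.^ h ℕ.* (surj h t ℕ.* (c C t))))
      ≡⟨ ∑<-cong (suc h) step ⟩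
    ∑< (suc h) (λ t → + coeff h t * + (2 ℕ.^ t ℕ.* (c C t))) ∎
    where
    rearrange : ∀ a b s c → a ℕ.* b ℕ.* (s ℕ.* c) ≡ s ℕ.* a ℕ.* (b ℕ.* c)
    rearrange = ℕSolver.solve-∀
    step : ∀ t → t < suc h → + (2 ℕ.^ h ℕ.* (surj h t ℕ.* (c C t))) ≡ + coeff h t * + (2 ℕ.^ t ℕ.* (c C t))
    step t (s≤s t≤h) = begin
      + (2 ℕ.^ h ℕ.* (surj h t ℕ.* (c C t)))
        ≡⟨ cong (λ e → + (2 ℕ.^ e ℕ.* (surj h t ℕ.* (c C t)))) (ℕ.m∸n+n≡m t≤h) ⟨
      + (2 ℕ.^ (h ∸ t ℕ.+ t) ℕ.* (surj h t ℕ.* (c C t)))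
        ≡⟨ cong (λ p → + (p ℕ.* (surj h t ℕ.* (c C t)))) (ℕ.^-distribˡ-+-* 2 (h ∸ t) t) ⟩
      + (2 ℕ.^ (h ∸ t) ℕ.* 2 ℕ.^ t ℕ.* (surj h t ℕ.* (c C t)))
        ≡⟨ cong +_ (rearrange (2 ℕ.^ (h ∸ t)) (2 ℕ.^ t) (surj h t) (c C t)) ⟩
      + (coeff h t ℕ.* (2 ℕ.^ t ℕ.* (c C t)))
        ≡⟨ ℤ.pos-* (coeff h t) (2 ℕ.^ t ℕ.* (c C t)) ⟩
      + coeff h t * + (2 ℕ.^ t ℕ.* (c C t)) ∎

  -- The contribution of one codeword of weight w to the h-th power moment, apart from the factor q.
  momentKernel : ℕ → ℕ → ℕ → ℤ
  momentKernel n h w = ∑< (suc h) (λ t → + coeff h t * kernel n w t)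

  -- After the MacWilliams expansion, a occurs only in the character λ(a Σ uᵢ gᵢ). Summing over a
  -- first leaves exactly the u with Σ uᵢ gᵢ = 0, each counted q times.
  pless : ∀ {n} (g : Vec F n) h →
    ∑ elems (λ a → (+ 2 * + trace-weight a g) ^ h)
    ≡ + q * ∑ (allBin n) (λ u → if isZero (dot u g) then momentKernel n h (wt u) else 0ℤ)
  pless {n} g h = begin
    ∑ elems (λ a → (+ 2 * + trace-weight a g) ^ h)
      ≡⟨ ∑-cong elems expand ⟩
    ∑ elems (λ a → ∑ B (λ u → λ' (a ⊛ dot u g) * momentKernel n h (wt u)))
      ≡⟨ ∑-swap elems B (λ a u → λ' (a ⊛ dot u g) * momentKernel n h (wt u)) ⟩
    ∑ B (λ u → ∑ elems (λ a → λ' (a ⊛ dot u g) * momentKernel n h (wt u)))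
      ≡⟨ ∑-cong B collapse ⟩
    ∑ B (λ u → + q * (if isZero (dot u g) then momentKernel n h (wt u) else 0ℤ))
      ≡⟨ *-∑ B (+ q) (λ u → if isZero (dot u g) then momentKernel n h (wt u) else 0ℤ) ⟩
    + q * ∑ B (λ u → if isZero (dot u g) then momentKernel n h (wt u) else 0ℤ) ∎
    where
    B = allBin n
    rearrange : ∀ x y z → x * (y * z) ≡ y * (x * z)
    rearrange = ℤSolver.solve-∀
    expand : ∀ a → (+ 2 * + trace-weight a g) ^ h ≡ ∑ B (λ u → λ' (a ⊛ dot u g) * momentKernel n h (wt u))
    expand a = begin
      (+ 2 * + trace-weight a g) ^ h
        ≡⟨ [2*c]^h (trace-weight a g) h ⟩
      ∑< (suc h) (λ t → + coeff h t * + (2 ℕ.^ t ℕ.* (trace-weight a g C t)))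
        ≡⟨ ∑-cong (upTo (suc h)) (λ t → trans (cong (+ coeff h t *_) (macWilliams g a t))
             (sym (*-∑ B (+ coeff h t) (λ u → λ' (a ⊛ dot u g) * kernel n (wt u) t)))) ⟩
      ∑< (suc h) (λ t → ∑ B (λ u → + coeff h t * (λ' (a ⊛ dot u g) * kernel n (wt u) t)))
        ≡⟨ ∑-swap (upTo (suc h)) B (λ t u → + coeff h t * (λ' (a ⊛ dot u g) * kernel n (wt u) t)) ⟩
      ∑ B (λ u → ∑< (suc h) (λ t → + coeff h t * (λ' (a ⊛ dot u g) * kernel n (wt u) t)))
        ≡⟨ ∑-cong B (λ u → trans
             (∑-cong (upTo (suc h)) (λ t → rearrange (+ coeff h t) (λ' (a ⊛ dot u g)) (kernel n (wt u) t)))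
             (*-∑ (upTo (suc h)) (λ' (a ⊛ dot u g)) (λ t → + coeff h t * kernel n (wt u) t))) ⟩
      ∑ B (λ u → λ' (a ⊛ dot u g) * momentKernel n h (wt u)) ∎
    *-if : ∀ b k → (if b then + q else 0ℤ) * k ≡ + q * (if b then k else 0ℤ)
    *-if true  k = refl
    *-if false k = sym (ℤ.*-zeroʳ (+ q))
    collapse : ∀ u → ∑ elems (λ a → λ' (a ⊛ dot u g) * momentKernel n h (wt u))
      ≡ + q * (if isZero (dot u g) then momentKernel n h (wt u) else 0ℤ)
    collapse u = begin
      ∑ elems (λ a → λ' (a ⊛ dot u g) * momentKernel n h (wt u))
        ≡⟨ ∑-* elems (λ a → λ' (a ⊛ dot u g)) (momentKernel n h (wt u)) ⟩
      ∑ elems (λ a → λ' (a ⊛ dot u g)) * momentKernel n h (wt u)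
        ≡⟨ cong (_* momentKernel n h (wt u)) (orthogonality (dot u g)) ⟩
      (if isZero (dot u g) then + q else 0ℤ) * momentKernel n h (wt u)
        ≡⟨ *-if (isZero (dot u g)) (momentKernel n h (wt u)) ⟩
      + q * (if isZero (dot u g) then momentKernel n h (wt u) else 0ℤ) ∎

  -- The cutoff M may lie below the length n, so words heavier than M, which match no index j, have
  -- to contribute 0.
  ∑-by-weight : ∀ {n} (g : Vec F n) M (H : ℕ → ℤ) → (∀ w → w ≤ n → M < w → H w ≡ 0ℤ) →
    ∑ (allBin n) (λ u → if isZero (dot u g) then H (wt u) else 0ℤ)
    ≡ ∑< (suc M) (λ j → + sumℕ (List.map (λ u → if does (wt u ℕ.≟ j) ∧ isZero (dot u g) then 1 else 0) (allBin n)) * H j)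
  ∑-by-weight {n} g M H H≡0 = sym (begin
    ∑< (suc M) (λ j → + ∑ℕ.∑ B (λ u → ind j u) * H j)
      ≡⟨ ∑-cong (upTo (suc M)) (λ j → trans (cong (_* H j) (pos-∑ B (ind j))) (sym (∑-* B (λ u → + ind j u) (H j)))) ⟩
    ∑< (suc M) (λ j → ∑ B (λ u → + ind j u * H j))
      ≡⟨ ∑-swap (upTo (suc M)) B (λ j u → + ind j u * H j) ⟩
    ∑ B (λ u → ∑< (suc M) (λ j → + ind j u * H j))
      ≡⟨ ∑-cong B (λ u → by-zero u (isZero (dot u g))) ⟩
    ∑ B (λ u → if isZero (dot u g) then H (wt u) else 0ℤ) ∎)
    where
    B = allBin n
    ind : ℕ → Vec Bool n → ℕ
    ind j u = if does (wt u ℕ.≟ j) ∧ isZero (dot u g) then 1 else 0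
    pick : ∀ b j → + (if b ∧ true then 1 else 0) * H j ≡ (if b then H j else 0ℤ)
    pick true  j = ℤ.*-identityˡ (H j)
    pick false j = refl
    drop : ∀ b j → + (if b ∧ false then 1 else 0) * H j ≡ 0ℤ
    drop true  j = refl
    drop false j = refl
    miss : ∀ {w} j → w ≢ j → (if does (w ℕ.≟ j) then H j else 0ℤ) ≡ 0ℤ
    miss {w} j w≢j = cong (λ b → if b then H j else 0ℤ) (dec-false (w ℕ.≟ j) w≢j)
    by-zero : ∀ u b → ∑< (suc M) (λ j → + (if does (wt u ℕ.≟ j) ∧ b then 1 else 0) * H j) ≡ (if b then H (wt u) else 0ℤ)
    by-zero u false = trans (∑-cong (upTo (suc M)) (λ j → drop (does (wt u ℕ.≟ j)) j)) (∑-zero (upTo (suc M)))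
    by-zero u true  = trans (∑-cong (upTo (suc M)) (λ j → pick (does (wt u ℕ.≟ j)) j)) selected
      where
      selected : ∑< (suc M) (λ j → if does (wt u ℕ.≟ j) then H j else 0ℤ) ≡ H (wt u)
      selected with wt u ℕ.≤? M
      ... | yes wt≤M = ∑<-indicator (suc M) (wt u) H (s≤s wt≤M)
      ... | no wt≰M  = trans
        (∑<-cong (suc M) (λ j j≤M → miss j (λ wt≡j → wt≰M (subst (_≤ M) (sym wt≡j) (ℕ.s≤s⁻¹ j≤M)))))
        (trans (∑-zero (upTo (suc M))) (sym (H≡0 (wt u) (wt≤n u) (ℕ.≰⇒> wt≰M))))

  -- The kernel polynomial is divisible by y^w, while only its coefficients up to y^h enter.
  momentKernel-zero : ∀ n h w → h < w → momentKernel n h w ≡ 0ℤ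
  momentKernel-zero n h w h<w = trans
    (∑<-cong (suc h) (λ t t≤h → trans
      (cong (λ c → + coeff h t * (sign w * + c)) (t<j⇒shiftC≡0 (n ∸ w) w t (ℕ.≤-<-trans (ℕ.s≤s⁻¹ t≤h) h<w)))
      (trans (cong (+ coeff h t *_) (ℤ.*-zeroʳ (sign w))) (ℤ.*-zeroʳ (+ coeff h t)))))
    (∑-zero (upTo (suc h)))

  -- Divisibility by y^j also removes the terms t < j, which produces the lower summation limit; the
  -- sign is that of (-y)^j.
  momentKernel-formula : ∀ N h j → j ≤ N → momentKernel N h j
    ≡ sign j * ∑ (range j h) (λ t → + (t !) * S h t * + (2 ℕ.^ (h ∸ t)) * + binomℤ (N ∸ j) (+ N - + t))
  momentKernel-formula N h j j≤N = begin
    ∑< (suc h) (λ t → + coeff h t * (sign j * + shiftC (N ∸ j) j t))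
      ≡⟨ ∑-cong (upTo (suc h)) (λ t → rearrange (+ coeff h t) (sign j) (+ shiftC (N ∸ j) j t)) ⟩
    ∑< (suc h) (λ t → sign j * (+ coeff h t * + shiftC (N ∸ j) j t))
      ≡⟨ *-∑ (upTo (suc h)) (sign j) (λ t → + coeff h t * + shiftC (N ∸ j) j t) ⟩
    sign j * ∑< (suc h) (λ t → + coeff h t * + shiftC (N ∸ j) j t)
      ≡⟨ cong (sign j *_) (∑<-drop j (suc h) (λ t → + coeff h t * + shiftC (N ∸ j) j t)
           (λ t t<j → trans (cong (λ c → + coeff h t * + c) (t<j⇒shiftC≡0 (N ∸ j) j t t<j)) (ℤ.*-zeroʳ (+ coeff h t)))) ⟩
    sign j * ∑< (suc h ∸ j) (λ s → + coeff h (j ℕ.+ s) * + shiftC (N ∸ j) j (j ℕ.+ s))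
      ≡⟨ cong (sign j *_) (∑-cong (upTo (suc h ∸ j)) (λ s → cong₂ _*_ (coeff-S (j ℕ.+ s))
           (cong +_ (trans (shiftC-+ (N ∸ j) j s) (C-binomℤ N j s j≤N))))) ⟩
    sign j * ∑< (suc h ∸ j) (summand ∘ (j ℕ.+_))
      ≡⟨ cong (sign j *_) (∑-range j h summand) ⟨
    sign j * ∑ (range j h) summand ∎
    where
    summand : ℕ → ℤ
    summand t = + (t !) * S h t * + (2 ℕ.^ (h ∸ t)) * + binomℤ (N ∸ j) (+ N - + t)
    rearrange : ∀ x y z → x * (y * z) ≡ y * (x * z)
    rearrange = ℤSolver.solve-∀
    coeff-S : ∀ t → + coeff h t ≡ + (t !) * S h t * + (2 ℕ.^ (h ∸ t))
    coeff-S t = trans (ℤ.pos-* (surj h t) (2 ℕ.^ (h ∸ t))) (cong (_* + (2 ℕ.^ (h ∸ t))) (sym (t!*S≡surj h t)))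

  module _ (m : ℕ) where
    private
      N = N₂ m
      point : Vec F m → F
      point v = vsum v ⊕ vinvsum v

    -- For a = 0 the trace word is zero, and 0^h = 0 for h ≥ 1, so the sum over the units may be
    -- completed to one over F and `pless` applies.
    Kl-moment : ∀ h → 1 ≤ h →
      Σ* (λ a → (- (Kl a ^ m) + + N) ^ h) ≡ + q * ∑< (suc (N ⊓ h)) (λ j → + D m j * momentKernel N h j)
    Kl-moment h 1≤h = begin
      Σ* (λ a → (- (Kl a ^ m) + + N) ^ h)
        ≡⟨ ∑-cong∈ elems* (λ {a} a∈ → cong (_^ h) (nonzero (∈-elems*⇒≢0 a∈))) ⟩
      ∑ elems* (λ a → (+ 2 * + trace-weight a (w m)) ^ h)
        ≡⟨ ℤ.+-identityˡ _ ⟨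
      0ℤ + ∑ elems* (λ a → (+ 2 * + trace-weight a (w m)) ^ h)
        ≡⟨ cong (_+ ∑ elems* (λ a → (+ 2 * + trace-weight a (w m)) ^ h)) (at-zero h 1≤h) ⟨
      (+ 2 * + trace-weight 0# (w m)) ^ h + ∑ elems* (λ a → (+ 2 * + trace-weight a (w m)) ^ h)
        ≡⟨ ∑-elems (λ a → (+ 2 * + trace-weight a (w m)) ^ h) ⟨
      ∑ elems (λ a → (+ 2 * + trace-weight a (w m)) ^ h)
        ≡⟨ pless (w m) h ⟩
      + q * ∑ (allBin N) (λ u → if isZero (dot u (w m)) then momentKernel N h (wt u) else 0ℤ)
        -- An attained weight above the minimum of N and h must exceed h, where the kernel vanishes.
        ≡⟨ cong (+ q *_) (∑-by-weight (w m) (N ⊓ h) (momentKernel N h)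
             (λ v v≤N M<v → momentKernel-zero N h v (ℕ.≰⇒> (λ v≤h → ℕ.<⇒≱ M<v (ℕ.⊓-glb v≤N v≤h))))) ⟩
      + q * ∑< (suc (N ⊓ h)) (λ j → + D m j * momentKernel N h j) ∎
      where
      nonzero : ∀ {a} → a ≢ 0# → - (Kl a ^ m) + + N ≡ + 2 * + trace-weight a (w m)
      nonzero {a} a≢0 = begin
        - (Kl a ^ m) + + N                                      ≡⟨ ℤ.+-comm (- (Kl a ^ m)) (+ N) ⟩
        + N - (Kl a ^ m)                                        ≡⟨ cong (λ z → + N - z) (∑-tuples-point a≢0 m) ⟨
        + N - ∑ (tuples m) (λ v → λ' (a ⊛ point v))           ≡⟨ 2*trace-weight point a (tuples m) ⟨
        + 2 * + trace-weight a (w m)                          ∎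
      weight-0 : + 2 * + trace-weight 0# (w m) ≡ 0ℤ
      weight-0 = trans (2*trace-weight point 0# (tuples m)) (trans (cong (λ z → + N - z) (∑-tuples-0 m)) (ℤ.+-inverseʳ (+ N)))
      at-zero : ∀ h → 1 ≤ h → (+ 2 * + trace-weight 0# (w m)) ^ h ≡ 0ℤ
      at-zero (suc h) _ = cong (λ z → z * (+ 2 * + trace-weight 0# (w m)) ^ h) weight-0

    Kl-moment-expanded : ∀ h → Σ* (λ a → (- (Kl a ^ m) + + N) ^ h)
      ≡ ∑< (suc h) (λ l → + (h C l) * (sign l * (+ N) ^ (h ∸ l) * MK (m ℕ.* l)))
    Kl-moment-expanded h = begin
      Σ* (λ a → (- (Kl a ^ m) + + N) ^ h)
        ≡⟨ ∑-cong elems* (λ a → binomial-theorem (- (Kl a ^ m)) (+ N) h) ⟩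
      ∑ elems* (λ a → ∑< (suc h) (λ l → + (h C l) * ((- (Kl a ^ m)) ^ l * (+ N) ^ (h ∸ l))))
        ≡⟨ ∑-swap elems* (upTo (suc h)) (λ a l → + (h C l) * ((- (Kl a ^ m)) ^ l * (+ N) ^ (h ∸ l))) ⟩
      ∑< (suc h) (λ l → ∑ elems* (λ a → + (h C l) * ((- (Kl a ^ m)) ^ l * (+ N) ^ (h ∸ l))))
        ≡⟨ ∑-cong (upTo (suc h)) step ⟩
      ∑< (suc h) (λ l → + (h C l) * (sign l * (+ N) ^ (h ∸ l) * MK (m ℕ.* l))) ∎
      where
      rearrange : ∀ c s k p → c * (s * k * p) ≡ c * (s * p) * k
      rearrange = ℤSolver.solve-∀
      step : ∀ l → ∑ elems* (λ a → + (h C l) * ((- (Kl a ^ m)) ^ l * (+ N) ^ (h ∸ l)))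
        ≡ + (h C l) * (sign l * (+ N) ^ (h ∸ l) * MK (m ℕ.* l))
      step l = begin
        ∑ elems* (λ a → + (h C l) * ((- (Kl a ^ m)) ^ l * (+ N) ^ (h ∸ l)))
          ≡⟨ ∑-cong elems* (λ a → trans
               (cong (λ z → + (h C l) * (z * (+ N) ^ (h ∸ l)))
                 (trans (neg-^ (Kl a ^ m) l) (cong (sign l *_) (ℤ.^-*-assoc (Kl a) m l))))
               (rearrange (+ (h C l)) (sign l) (Kl a ^ (m ℕ.* l)) ((+ N) ^ (h ∸ l)))) ⟩
        ∑ elems* (λ a → + (h C l) * (sign l * (+ N) ^ (h ∸ l)) * Kl a ^ (m ℕ.* l))
          ≡⟨ *-∑ elems* (+ (h C l) * (sign l * (+ N) ^ (h ∸ l))) (λ a → Kl a ^ (m ℕ.* l)) ⟩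
        + (h C l) * (sign l * (+ N) ^ (h ∸ l)) * MK (m ℕ.* l)
          ≡⟨ ℤ.*-assoc (+ (h C l)) (sign l * (+ N) ^ (h ∸ l)) (MK (m ℕ.* l)) ⟩
        + (h C l) * (sign l * (+ N) ^ (h ∸ l) * MK (m ℕ.* l)) ∎

    MK-recursion : ∀ h → 1 ≤ h →
      MK (m ℕ.* h) ≡
        sumℤ (List.map (λ l → sign (h ℕ.+ l ℕ.+ 1) * + (h C l) * (+ (q ∸ 1)) ^ (m ℕ.* (h ∸ l)) * MK (m ℕ.* l)) (range 0 (h ∸ 1)))
        + + q * sumℤ (List.map (λ j → sign (h ℕ.+ j) * + D m j *
                  sumℤ (List.map (λ t → + (t !) * S h t * + (2 ℕ.^ (h ∸ t))
                                          * + binomℤ ((q ∸ 1) ℕ.^ m ∸ j) (+ ((q ∸ 1) ℕ.^ m) - + t))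
                                 (range j h)))
                (range 0 ((q ∸ 1) ℕ.^ m ⊓ h)))
    -- The rewrite turns `(q ∸ 1) ℕ.^ m` into `N₂ m`. The integer power of `+ (q ∸ 1)` in the first
    -- sum is not of that form and is matched by `N-power`.
    MK-recursion h@(suc h′) 1≤h rewrite sym (N₂≡[q∸1]^m m) = begin
      MK (m ℕ.* h)
        -- The top term is `sign h` times the wanted moment, and `sign h` is its own inverse.
        ≡⟨ isolate (sign h) (∑< h L) (MK (m ℕ.* h)) Y (sign-square h) balance ⟩
      - sign h * ∑< h L + sign h * Y
        ≡⟨ cong₂ _+_ lower upper ⟩
      ∑ (range 0 (h ∸ 1)) summandˡ + + q * ∑ (range 0 (N ⊓ h)) summandʳ ∎
      where
      L summandˡ summandʳ : ℕ → ℤ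
      L l = + (h C l) * (sign l * (+ N) ^ (h ∸ l) * MK (m ℕ.* l))
      summandˡ l = sign (h ℕ.+ l ℕ.+ 1) * + (h C l) * (+ (q ∸ 1)) ^ (m ℕ.* (h ∸ l)) * MK (m ℕ.* l)
      summandʳ j = sign (h ℕ.+ j) * + D m j *
        ∑ (range j h) (λ t → + (t !) * S h t * + (2 ℕ.^ (h ∸ t)) * + binomℤ (N ∸ j) (+ N - + t))
      Y : ℤ
      Y = + q * ∑< (suc (N ⊓ h)) (λ j → + D m j * momentKernel N h j)
      L-h : L h ≡ sign h * MK (m ℕ.* h)
      L-h = begin
        + (h C h) * (sign h * (+ N) ^ (h ∸ h) * MK (m ℕ.* h))
          ≡⟨ cong₂ (λ c e → + c * (sign h * (+ N) ^ e * MK (m ℕ.* h))) (nCn≡1 h) (ℕ.n∸n≡0 h) ⟩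
        1ℤ * (sign h * 1ℤ * MK (m ℕ.* h))
          ≡⟨ rearrange (sign h) (MK (m ℕ.* h)) ⟩
        sign h * MK (m ℕ.* h) ∎
        where
        rearrange : ∀ s k → 1ℤ * (s * 1ℤ * k) ≡ s * k
        rearrange = ℤSolver.solve-∀
      balance : ∑< h L + sign h * MK (m ℕ.* h) ≡ Y
      balance = begin
        ∑< h L + sign h * MK (m ℕ.* h)   ≡⟨ cong (λ z → ∑< h L + z) L-h ⟨
        ∑< h L + L h                     ≡⟨ ∑<-last h L ⟨
        ∑< (suc h) L                     ≡⟨ Kl-moment-expanded h ⟨
        Σ* (λ a → (- (Kl a ^ m) + + N) ^ h) ≡⟨ Kl-moment h 1≤h ⟩
        Y                                ∎
      isolate : ∀ s l k y → s * s ≡ 1ℤ → l + s * k ≡ y → k ≡ - s * l + s * y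
      isolate s l k y s²≡1 refl = begin
        k                             ≡⟨ ℤ.*-identityˡ k ⟨
        1ℤ * k                        ≡⟨ cong (_* k) s²≡1 ⟨
        s * s * k                     ≡⟨ rearrange s l k ⟩
        - s * l + s * (l + s * k)     ∎
        where
        rearrange : ∀ s l k → s * s * k ≡ - s * l + s * (l + s * k)
        rearrange = ℤSolver.solve-∀
      lower : - sign h * ∑< h L ≡ ∑ (range 0 (h ∸ 1)) summandˡ
      lower = begin
        - sign h * ∑< h L                      ≡⟨ *-∑ (upTo h) (- sign h) L ⟨
        ∑< h (λ l → - sign h * L l)            ≡⟨ ∑-cong (upTo h) step ⟩
        ∑< h summandˡ                          ≡⟨ ∑-range 0 h′ summandˡ ⟨
        ∑ (range 0 (h ∸ 1)) summandˡ           ∎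
        where
        rearrange : ∀ s c s′ p k → - s * (c * (s′ * p * k)) ≡ s * s′ * -1ℤ * c * p * k
        rearrange = ℤSolver.solve-∀
        sign-sum : ∀ l → sign (h ℕ.+ l ℕ.+ 1) ≡ sign h * sign l * -1ℤ
        sign-sum l = trans (sign-+ (h ℕ.+ l) 1) (cong (_* -1ℤ) (sign-+ h l))
        N-power : ∀ l → (+ N) ^ (h ∸ l) ≡ (+ (q ∸ 1)) ^ (m ℕ.* (h ∸ l))
        N-power l = trans (cong (_^ (h ∸ l)) (trans (cong +_ (N₂≡[q∸1]^m m)) (pos-^ (q ∸ 1) m))) (ℤ.^-*-assoc (+ (q ∸ 1)) m (h ∸ l))
        step : ∀ l → - sign h * L l ≡ summandˡ l
        step l = trans (rearrange (sign h) (+ (h C l)) (sign l) ((+ N) ^ (h ∸ l)) (MK (m ℕ.* l)))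
          (cong₂ (λ s p → s * + (h C l) * p * MK (m ℕ.* l)) (sym (sign-sum l)) (N-power l))
      upper : sign h * Y ≡ + q * ∑ (range 0 (N ⊓ h)) summandʳ
      upper = begin
        sign h * (+ q * ∑< (suc (N ⊓ h)) (λ j → + D m j * momentKernel N h j))
          ≡⟨ swap (sign h) (+ q) (∑< (suc (N ⊓ h)) (λ j → + D m j * momentKernel N h j)) ⟩
        + q * (sign h * ∑< (suc (N ⊓ h)) (λ j → + D m j * momentKernel N h j))
          ≡⟨ cong (+ q *_) (*-∑ (upTo (suc (N ⊓ h))) (sign h) (λ j → + D m j * momentKernel N h j)) ⟨
        + q * ∑< (suc (N ⊓ h)) (λ j → sign h * (+ D m j * momentKernel N h j))
          ≡⟨ cong (+ q *_) (∑<-cong (suc (N ⊓ h)) step) ⟩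
        + q * ∑< (suc (N ⊓ h)) summandʳ
          ≡⟨ cong (+ q *_) (∑-range 0 (N ⊓ h) summandʳ) ⟨
        + q * ∑ (range 0 (N ⊓ h)) summandʳ ∎
        where
        swap : ∀ x y z → x * (y * z) ≡ y * (x * z)
        swap = ℤSolver.solve-∀
        rearrange : ∀ s d s′ k → s * (d * (s′ * k)) ≡ s * s′ * d * k
        rearrange = ℤSolver.solve-∀
        step : ∀ j → j < suc (N ⊓ h) → sign h * (+ D m j * momentKernel N h j) ≡ summandʳ j
        step j j≤M = begin
          sign h * (+ D m j * momentKernel N h j)
            ≡⟨ cong (λ z → sign h * (+ D m j * z)) (momentKernel-formula N h j (ℕ.≤-trans (ℕ.s≤s⁻¹ j≤M) (ℕ.m⊓n≤m N h))) ⟩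
          sign h * (+ D m j * (sign j * I))
            ≡⟨ rearrange (sign h) (+ D m j) (sign j) I ⟩
          sign h * sign j * + D m j * I
            ≡⟨ cong (λ s → s * + D m j * I) (sign-+ h j) ⟨
          summandʳ j ∎
          where I = ∑ (range j h) (λ t → + (t !) * S h t * + (2 ℕ.^ (h ∸ t)) * + binomℤ (N ∸ j) (+ N - + t))

open import Data.Nat using (_+_; _*_; _^_)
open import Data.Integer using (+_)

theorem1 : (r : ℕ) → 3 ≤ r → (K : GF2^ r) → (m : ℕ) → 1 ≤ m →
  let open FF K in
  (∀ (h : ℕ) → 1 ≤ h →
    MK (m * h) ≡
      sumℤ (List.map (λ l → sign (h + l + 1) ℤ.* + (h C l) ℤ.* (+ (q ∸ 1)) ℤ.^ (m * (h ∸ l)) ℤ.* MK (m * l))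
                     (range 0 (h ∸ 1)))
      ℤ.+ + q ℤ.* sumℤ (List.map (λ j → sign (h + j) ℤ.* + D m j ℤ.*
                         sumℤ (List.map (λ t → + (t !) ℤ.* S h t ℤ.* + (2 ^ (h ∸ t))
                                                ℤ.* + binomℤ ((q ∸ 1) ^ m ∸ j) (+ ((q ∸ 1) ^ m) ℤ.- + t))
                                        (range j h)))
                       (range 0 ((q ∸ 1) ^ m ⊓ h))))
  × (∀ (j : ℕ) → D m j ≡ Dformula m j)
  × (∀ (β : GF2^.F K) → + q ℤ.* + σ m β ≡ + q ℤ.* σsum m β ℤ.+ (+ ((q ∸ 1) ^ m) ℤ.+ sign (m + 1)))
theorem1 (suc r′) _ K m _ = MK-recursion m , D≡Dformula m , σ-formula m
  where
  open Characters r′ K using (σ-formula)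
  open WeightEnumerator r′ K using (D≡Dformula)
  open PowerMoments r′ K using (MK-recursion)
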